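{- There exist positive constants $C$ and $r_0$ such that for all $r\ge r_0$, \[ 2^{\log^2 r/36} \le F_\chi(r,4,3) \le C\cdot 2^{130\sqrt{r\log r}}. \]
   Context: Logarithms are base 2. A graph is $p$-chromatic if its chromatic number is exactly $p$. For $p\ge3$, $2\le q\le\binom p2$ and positive integer $r$, $F_\chi(r,p,q)$ is the minimum integer $n$ such that every edge coloring of $K_n$ with $r$ colors contains a $p$-chromatic subgraph whose edges receive at most $q-1$ distinct colors. -}

module Defs where

open import Level using (0ℓ)
open import Data.Bool using (Bool; true; T)
open import Data.Bool.Properties using (T?)
open import Data.Fin using (Fin; _≟_)
open import Data.Fin.Properties using (any?)
open import Data.Fin.Subset using (Subset; _∈_; ∣_∣)
open import Data.Integer as ℤ using (+_)
open import Data.Nat as ℕ using (ℕ; _≤_; _∸_)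
open import Data.Product using (Σ; ∃; ∃₂; _×_; proj₁)
open import Data.Rational as ℚ using (ℚ; 0ℚ; ↥_; ↧ₙ_)
open import Data.Vec using (tabulate)
open import Relation.Binary.Core using (Rel)
open import Relation.Binary.Definitions using (Symmetric; Irreflexive)
open import Relation.Binary.PropositionalEquality using (_≡_; _≢_; refl)
open import Relation.Nullary using (¬_)
open import Relation.Nullary.Decidable using (does; _×-dec_)
open import Relation.Unary using (Pred; _⊆_)

------------------------------------------------------------------------
-- Graphs and chromatic number

record Graph : Set₁ where
  field
    Vertex      : Set
    Adj         : Rel Vertex 0ℓ
    symmetric   : Symmetric Adj
    irreflexive : Irreflexive _≡_ Adj

Colourable : Graph → ℕ → Set
Colourable G k = Σ (Vertex → Fin k) λ f → ∀ {u v} → Adj u v → f u ≢ f v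
  where open Graph G

_IsChromatic_ : ℕ → Graph → Set
p IsChromatic G = Colourable G p × (∀ k → Colourable G k → p ≤ k)

-- A subgraph of the complete graph on Fin n: a set of vertices together
-- with a set of edges (distinct pairs) all of whose ends lie in it.

record Subgraph (n : ℕ) : Set where
  field
    vertices   : Subset n
    edge       : Fin n → Fin n → Bool
    edge-sym   : ∀ {u v} → T (edge u v) → T (edge v u)
    edge-irr   : ∀ {u} → ¬ T (edge u u)
    edge-end   : ∀ {u v} → T (edge u v) → u ∈ vertices

  graph : Graph
  graph = record
    { Vertex      = ∃ (_∈ vertices)
    ; Adj         = λ u v → T (edge (proj₁ u) (proj₁ v))
    ; symmetric   = edge-sym
    ; irreflexive = λ { refl → edge-irr }
    }

------------------------------------------------------------------------
-- Edge colourings of complete graphs and F_χ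

-- The values on the diagonal are never used, since a Subgraph has no loops.

record EdgeColouring (n r : ℕ) : Set where
  field
    colour     : Fin n → Fin n → Fin r
    colour-sym : ∀ u v → colour u v ≡ colour v u

coloursOn : ∀ {n r} → EdgeColouring n r → Subgraph n → Subset r
coloursOn c H = tabulate λ i →
  does (any? λ u → any? λ v → T? (edge u v) ×-dec (colour u v ≟ i))
  where open EdgeColouring c
        open Subgraph H

ChromaticRamsey : (r p q n : ℕ) → Set
ChromaticRamsey r p q n = (c : EdgeColouring n r) →
  ∃ λ (H : Subgraph n) →
    p IsChromatic Subgraph.graph H × ∣ coloursOn c H ∣ ≤ q ∸ 1

-- n IsFχ⟨ r , p , q ⟩ says that F_χ(r,p,q) is defined and equal to n.

_IsFχ⟨_,_,_⟩ : (n r p q : ℕ) → Set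
n IsFχ⟨ r , p , q ⟩ =
  ChromaticRamsey r p q n × (∀ m → ChromaticRamsey r p q m → n ≤ m)

------------------------------------------------------------------------
-- Non-negative reals

-- A real x ≥ 0 is given by its upper Dedekind cut { s ∈ ℚ | x < s }, which
-- contains only positive rationals.  The type itself does not demand the
-- laws of a cut, so it should not be quantified over; every operation below
-- yields exactly { s | result < s } when its arguments are cuts.

Cut : Set₁
Cut = Pred ℚ 0ℓ

infix  4 _≤ᴿ_
infixl 7 _*ᴿ_ _/ᴿ_
infixr 8 2^_
infix  9 _²

-- x ≤ y iff every rational above y is above x.

_≤ᴿ_ : Cut → Cut → Set
x ≤ᴿ y = y ⊆ x

-- Used for c ≥ 0 only.

fromℚ : ℚ → Cut
fromℚ c s = c ℚ.< s

fromℕ : ℕ → Cut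
fromℕ n = fromℚ (+ n ℚ./ 1)

_*ᴿ_ : Cut → Cut → Cut
(x *ᴿ y) s = ∃₂ λ t u → x t × y u × t ℚ.* u ℚ.≤ s

_/ᴿ_ : Cut → (k : ℕ) .{{_ : ℕ.NonZero k}} → Cut
x /ᴿ k = x *ᴿ fromℚ (+ 1 ℚ./ k)

_² : Cut → Cut
x ² = x *ᴿ x

√ : Cut → Cut
√ x s = 0ℚ ℚ.< s × x (s ℚ.* s)

-- Base-2 logarithm of m ≥ 1: for s = a/b > 0, log m < a/b iff m^b < 2^a.

log₂ : ℕ → Cut
log₂ m s = 0ℚ ℚ.< s × m ℕ.^ (↧ₙ s) ℕ.< 2 ℕ.^ ℤ.∣ ↥ s ∣

-- For t = a/b > 0 and s = c/d > 0, 2^(a/b) ≤ c/d iff 2^a · d^b ≤ c^b.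

Pow2≤ : ℚ → ℚ → Set
Pow2≤ t s =
  2 ℕ.^ ℤ.∣ ↥ t ∣ ℕ.* (↧ₙ s) ℕ.^ (↧ₙ t) ℕ.≤ ℤ.∣ ↥ s ∣ ℕ.^ (↧ₙ t)

-- 2^x < s iff 2^t ≤ s for some rational t > x.

2^_ : Cut → Cut
(2^ x) s = 0ℚ ℚ.< s × ∃ λ t → x t × Pow2≤ t s

{-# OPTIONS --safe #-}
module Submission where

-- Lower bound.  Take the points x ∈ {0,…,2^t−1}^t with 2t ≤ log r, and colour xy by the set S of
-- the coordinates in which x and y differ together with min(xᵢ,yᵢ), where i is an element of S
-- determined by S.  Exactly one end of an edge of colour (p , S) has i-th coordinate p, and
-- this makes the union of any two colour classes 3-colourable.
--
-- Upper bound.  Suppose that every union of colour classes i and j has a proper 3-colouring fᵢⱼ,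
-- let V be a set of N vertices using only k ≤ 2^L colours, and let D be about 2√(kL).  If two
-- vertices u, v differ under fᵢⱼ, then their common i-neighbourhood receives a single value
-- of fᵢⱼ and hence contains no edge of colour j.  Counting monochromatic paths u – w – v gives
-- i and u such that the codegrees in colour i sum to about N²/k³ over v ∈ V.  Either some v with
-- codegree ≥ N/8k³ differs from u under at least D of the fᵢⱼ, and the common neighbourhood of u
-- and v avoids D colours; or there are N/8k³ vertices differing from u under fewer than D
-- of them.  In the latter case repeatedly choose the colour j for which the fewest remaining
-- vertices differ from u, and discard these vertices: removing k/4D colours costs at most half
-- of the vertices, so that removing D of them costs a factor 2^O(D²/k) = 2^O(L).  Either way D
-- colours are lost for a factor 2^O(L), and iterating yields N ≤ 2^O(√(rL)).

open import Defs
open import Data.Nat using (ℕ; _≤_; _<_)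
open import Data.Product using (∃; ∃₂; _×_)
open import Data.Rational as ℚ using (ℚ; 0ℚ)
import Algebra.Construct.NaturalChoice.Min as Min
open import Data.Bool using (Bool; true; false; _∧_; not; if_then_else_; _xor_; T)
open import Data.Bool.Properties using (T?; T-≡)
open import Data.Fin as Fin using (Fin; zero; suc; finToFun; funToFin; combine; remQuot; toℕ; inject≤; inject₁)
open import Data.Fin.Properties as Finₚ using (finToFun-funToFin; funToFin-finToFin; remQuot-combine; toℕ-injective; toℕ-inject≤; toℕ<n; toℕ-fromℕ<; any?; all?; inject₁-injective; fromℕ≢inject₁; inject≤-injective)
open import Data.Fin.Subset as Subset using (Subset; _∈_; ∣_∣; _∪_; _-_)
open import Data.Fin.Subset.Properties using (nonempty?; p⊆q⇒∣p∣≤∣q∣; ∣⁅x⁆∣≡1; x∈⁅x⁆; x∈p∪q⁺; x∈p∧x≢y⇒x∈p-y; x∈p⇒∣p-x∣<∣p∣; _∈?_)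
import Data.Integer as ℤ
import Data.Integer.Properties as ℤₚ
open import Data.Nat using (zero; suc; _+_; _*_; _∸_; _^_; _/_; _%_; z≤n; s≤s; NonZero; >-nonZero)
open import Data.Nat.Coprimality as Coprimality using (1-coprimeTo)
open import Data.Nat.DivMod using (_mod_; m<n⇒m%n≡m; m≡m%n+[m/n]*n; m%n<n; m/n*n≤m)
open import Data.Nat.Properties
open import Data.Nat.Tactic.RingSolver using (solve-∀)
open import Data.Product using (Σ; _,_; proj₁; proj₂)
open import Data.Rational using (mkℚ; 1ℚ; ↥_; ↧ₙ_; *<*; *≤*)
import Data.Rational.Properties as ℚₚ
open import Data.Rational.Solver using (module +-*-Solver)
open import Data.Sum using (_⊎_; inj₁; inj₂)
open import Data.Vec using (tabulate; []; _∷_)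
open import Data.Vec.Properties using (lookup∘tabulate; []=⇒lookup; lookup⇒[]=)
open import Function using (_∘_; Equivalence)
open import Relation.Binary.PropositionalEquality
open import Relation.Nullary using (¬_; Dec; yes; no; contradiction)
open import Relation.Nullary.Decidable using (does; dec-true; dec-false; from-yes; toWitness; fromWitness; isYes; map′; decidable-stable; ¬?; _×-dec_; _⊎-dec_; _→-dec_)
open import Algebra.Properties.Semiring.Sum +-*-semiring using (sum; ∑-distrib-+; ∑-comm; sum-cong-≗; *-distribˡ-sum; *-distribʳ-sum)

-- Sums over finite sets

private variable
  n r : ℕ

sum-mono : {f g : Fin n → ℕ} → (∀ x → f x ≤ g x) → sum f ≤ sum g
sum-mono {zero}  f≤g = z≤n
sum-mono {suc n} f≤g = +-mono-≤ (f≤g zero) (sum-mono (f≤g ∘ suc))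

term≤sum : (f : Fin n → ℕ) (x : Fin n) → f x ≤ sum f
term≤sum f zero    = m≤m+n _ _
term≤sum f (suc x) = ≤-trans (term≤sum (f ∘ suc) x) (m≤n+m _ _)

sum-zero : {f : Fin n → ℕ} → (∀ x → f x ≡ 0) → sum f ≡ 0
sum-zero {zero}  f≡0 = refl
sum-zero {suc n} f≡0 = cong₂ _+_ (f≡0 zero) (sum-zero (f≡0 ∘ suc))

⟦_⟧ : Bool → ℕ
⟦ true ⟧  = 1
⟦ false ⟧ = 0

⟦⟧≤ : ∀ {b m} → (b ≡ true → 1 ≤ m) → ⟦ b ⟧ ≤ m
⟦⟧≤ {true}  1≤m = 1≤m refl
⟦⟧≤ {false} _   = z≤n

⟦∧⟧ : ∀ a b → ⟦ a ∧ b ⟧ ≡ ⟦ a ⟧ * ⟦ b ⟧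
⟦∧⟧ true  b = sym (+-identityʳ ⟦ b ⟧)
⟦∧⟧ false b = refl

_∩_ : (Fin n → Bool) → (Fin n → Bool) → Fin n → Bool
(p ∩ q) x = p x ∧ q x

∁ : (Fin n → Bool) → Fin n → Bool
∁ p x = not (p x)

_⊑_ : (Fin n → Bool) → (Fin n → Bool) → Set
p ⊑ q = ∀ x → p x ≡ true → q x ≡ true

∧-true : ∀ {a b} → a ∧ b ≡ true → a ≡ true × b ≡ true
∧-true {true} {true} _ = refl , refl

∧-true⁺ : ∀ {a b} → a ≡ true → b ≡ true → a ∧ b ≡ true
∧-true⁺ refl refl = refl

not-true : ∀ {a} → not a ≡ true → a ≡ false
not-true {false} _ = refl

∑⟨_⟩ : (Fin n → Bool) → (Fin n → ℕ) → ℕ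
∑⟨ p ⟩ g = sum (λ x → ⟦ p x ⟧ * g x)

# : (Fin n → Bool) → ℕ
# p = sum (λ x → ⟦ p x ⟧)

⟦⟧-mono : ∀ {a b} → (a ≡ true → b ≡ true) → ⟦ a ⟧ ≤ ⟦ b ⟧
⟦⟧-mono imp = ⟦⟧≤ λ a → ≤-reflexive (sym (cong ⟦_⟧ (imp a)))

#-mono : (p q : Fin n → Bool) → p ⊑ q → # p ≤ # q
#-mono p q p⊑q = sum-mono (λ x → ⟦⟧-mono (p⊑q x))

#-full : (p : Fin n → Bool) → (∀ x → p x ≡ true) → # p ≡ n
#-full {zero}  p full = refl
#-full {suc n} p full rewrite full zero = cong suc (#-full (p ∘ suc) (full ∘ suc))

#≤n : (p : Fin n → Bool) → # p ≤ n
#≤n p = subst (# p ≤_) (#-full (λ _ → true) (λ _ → refl)) (#-mono p (λ _ → true) (λ _ _ → refl))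

∑-mono : (p : Fin n → Bool) {f g : Fin n → ℕ} →
         (∀ x → p x ≡ true → f x ≤ g x) → ∑⟨ p ⟩ f ≤ ∑⟨ p ⟩ g
∑-mono p {f} {g} f≤g = sum-mono λ x → go (p x) (f≤g x)
  where
  go : ∀ b {u v} → (b ≡ true → u ≤ v) → ⟦ b ⟧ * u ≤ ⟦ b ⟧ * v
  go true  u≤v = *-monoʳ-≤ 1 (u≤v refl)
  go false _   = z≤n

∈⇒≤∑ : (p : Fin n → Bool) (g : Fin n → ℕ) (x : Fin n) → p x ≡ true → g x ≤ ∑⟨ p ⟩ g
∈⇒≤∑ p g x px = ≤-trans (≤-reflexive (sym (trans (cong (λ b → ⟦ b ⟧ * g x) px) (*-identityˡ (g x)))))
                        (term≤sum (λ y → ⟦ p y ⟧ * g y) x)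

∑-cong : (p : Fin n → Bool) {g h : Fin n → ℕ} → (∀ x → g x ≡ h x) → ∑⟨ p ⟩ g ≡ ∑⟨ p ⟩ h
∑-cong p g≡h = sum-cong-≗ λ x → cong (⟦ p x ⟧ *_) (g≡h x)

∑-const : (p : Fin n → Bool) (c : ℕ) → ∑⟨ p ⟩ (λ _ → c) ≡ # p * c
∑-const p c = sym (*-distribʳ-sum c (λ x → ⟦ p x ⟧))

∑-≤ : (p : Fin n → Bool) (g : Fin n → ℕ) (c : ℕ) →
      (∀ x → p x ≡ true → g x ≤ c) → ∑⟨ p ⟩ g ≤ # p * c
∑-≤ p g c g≤c = ≤-trans (∑-mono p g≤c) (≤-reflexive (∑-const p c))

∑-≥ : (p : Fin n → Bool) (g : Fin n → ℕ) (c : ℕ) →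
      (∀ x → p x ≡ true → c ≤ g x) → # p * c ≤ ∑⟨ p ⟩ g
∑-≥ p g c c≤g = ≤-trans (≤-reflexive (sym (∑-const p c))) (∑-mono p c≤g)

*-∑ : (c : ℕ) (p : Fin n → Bool) (g : Fin n → ℕ) →
      c * ∑⟨ p ⟩ g ≡ ∑⟨ p ⟩ (λ x → c * g x)
*-∑ c p g = trans (*-distribˡ-sum c (λ x → ⟦ p x ⟧ * g x))
                  (sum-cong-≗ λ x → eq c ⟦ p x ⟧ (g x))
  where
  eq : ∀ a b d → a * (b * d) ≡ b * (a * d)
  eq = solve-∀

∑-swap : (p : Fin n → Bool) (q : Fin r → Bool) (g : Fin n → Fin r → ℕ) →
         ∑⟨ p ⟩ (λ x → ∑⟨ q ⟩ (g x)) ≡ ∑⟨ q ⟩ (λ y → ∑⟨ p ⟩ (λ x → g x y))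
∑-swap p q g = begin
  sum (λ x → ⟦ p x ⟧ * ∑⟨ q ⟩ (g x))
    ≡⟨ sum-cong-≗ (λ x → *-∑ ⟦ p x ⟧ q (g x)) ⟩
  sum (λ x → sum (λ y → ⟦ q y ⟧ * (⟦ p x ⟧ * g x y)))
    ≡⟨ ∑-comm (λ x y → ⟦ q y ⟧ * (⟦ p x ⟧ * g x y)) ⟩
  sum (λ y → sum (λ x → ⟦ q y ⟧ * (⟦ p x ⟧ * g x y)))
    ≡⟨ sum-cong-≗ (λ y → sym (*-distribˡ-sum ⟦ q y ⟧ (λ x → ⟦ p x ⟧ * g x y))) ⟩
  sum (λ y → ⟦ q y ⟧ * sum (λ x → ⟦ p x ⟧ * g x y)) ∎
  where open ≡-Reasoning

∑-split : (p q : Fin n → Bool) (g : Fin n → ℕ) →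
          ∑⟨ p ⟩ g ≡ ∑⟨ p ∩ q ⟩ g + ∑⟨ p ∩ ∁ q ⟩ g
∑-split p q g = trans (sum-cong-≗ λ x → go (p x) (q x) (g x))
                      (∑-distrib-+ (λ x → ⟦ p x ∧ q x ⟧ * g x) _)
  where
  go : ∀ a b c → ⟦ a ⟧ * c ≡ ⟦ a ∧ b ⟧ * c + ⟦ a ∧ not b ⟧ * c
  go true  true  c = sym (+-identityʳ _)
  go true  false c = refl
  go false b     c = refl

#-split : (p q : Fin n → Bool) → # p ≡ # (p ∩ q) + # (p ∩ ∁ q)
#-split p q = trans (sum-cong-≗ λ x → go (p x) (q x))
                    (∑-distrib-+ (λ x → ⟦ p x ∧ q x ⟧) _)
  where
  go : ∀ a b → ⟦ a ⟧ ≡ ⟦ a ∧ b ⟧ + ⟦ a ∧ not b ⟧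
  go true  true  = refl
  go true  false = refl
  go false b     = refl

#-∩ : (p q : Fin n → Bool) → # (p ∩ q) ≡ ∑⟨ p ⟩ (λ x → ⟦ q x ⟧)
#-∩ p q = sum-cong-≗ λ x → ⟦∧⟧ (p x) (q x)

does-true : ∀ {P : Set} (P? : Dec P) → does P? ≡ true → P
does-true (yes p) _ = p

does-false : ∀ {P : Set} (P? : Dec P) → does P? ≡ false → ¬ P
does-false (no ¬p) _ = ¬p

⁅_⁆ : Fin n → Fin n → Bool
⁅ x ⁆ y = does (y Fin.≟ x)

#-singleton : (x : Fin n) → # ⁅ x ⁆ ≡ 1
#-singleton {suc n} zero = cong suc (sum-zero {n} {λ y → ⟦ ⁅ zero ⁆ (suc y) ⟧} λ _ → refl)
#-singleton (suc x) = #-singleton x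

⁅⁆-true : ∀ {x y : Fin n} → ⁅ x ⁆ y ≡ true → y ≡ x
⁅⁆-true {x = x} {y} = does-true (y Fin.≟ x)

∁⁅⁆-true : ∀ {x y : Fin n} → not (⁅ x ⁆ y) ≡ true → y ≢ x
∁⁅⁆-true {x = x} {y} eq = does-false (y Fin.≟ x) (not-true eq)

∁⁅⁆-true⁺ : ∀ {x y : Fin n} → y ≢ x → not (⁅ x ⁆ y) ≡ true
∁⁅⁆-true⁺ {x = x} {y} y≢x = cong not (dec-false (y Fin.≟ x) y≢x)

#-∩-singleton : (p : Fin n → Bool) (x : Fin n) → # (p ∩ ⁅ x ⁆) ≤ 1
#-∩-singleton p x = ≤-trans (#-mono (p ∩ ⁅ x ⁆) ⁅ x ⁆ (λ y → proj₂ ∘ ∧-true)) (≤-reflexive (#-singleton x))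

#-remove : (p : Fin n → Bool) (x : Fin n) → p x ≡ true → # p ≡ suc (# (p ∩ ∁ ⁅ x ⁆))
#-remove p x px = trans (#-split p ⁅ x ⁆)
  (cong (_+ # (p ∩ ∁ ⁅ x ⁆)) (≤-antisym (#-∩-singleton p x)
    (subst (_≤ # (p ∩ ⁅ x ⁆)) (#-singleton x) (#-mono ⁅ x ⁆ (p ∩ ⁅ x ⁆) λ y y≡x → ∧-true⁺ (trans (cong p (⁅⁆-true y≡x)) px) y≡x))))

#≥1 : (p : Fin n → Bool) (x : Fin n) → p x ≡ true → 1 ≤ # p
#≥1 p x px = subst (1 ≤_) (sym (#-remove p x px)) (s≤s z≤n)

#≡0 : (p : Fin n → Bool) → # p ≡ 0 → ∀ x → p x ≡ false
#≡0 p #p≡0 x with p x in eq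
... | false = refl
... | true  = contradiction (subst (1 ≤_) #p≡0 (#≥1 p x eq)) λ ()

-- The largest term is at least the average, written without division. Positivity of the sum
-- guarantees that `p` has an element.
∑-pigeonhole : (p : Fin n → Bool) (g : Fin n → ℕ) → 0 < ∑⟨ p ⟩ g →
               ∃ λ x → p x ≡ true × ∑⟨ p ⟩ g ≤ # p * g x
∑-pigeonhole {n} p g pos with go p g
  where
  go : ∀ {n} (p : Fin n → Bool) (g : Fin n → ℕ) →
       ∑⟨ p ⟩ g ≡ 0 ⊎ ∃ λ x → p x ≡ true × ∑⟨ p ⟩ g ≤ # p * g x
  go {zero}  p g = inj₁ refl
  go {suc n} p g with p zero in eq | go (p ∘ suc) (g ∘ suc)
  ... | false | inj₁ z = inj₁ z
  ... | false | inj₂ (x , px , le) = inj₂ (suc x , px , le)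
  ... | true  | inj₁ z = inj₂ (zero , eq , ≤-trans
    (≤-reflexive (trans (cong (1 * g zero +_) z) (trans (+-identityʳ _) (*-identityˡ _))))
    (m≤m+n (g zero) _))
  ... | true  | inj₂ (x , px , le) with ≤-total (g zero) (g (suc x))
  ...   | inj₁ le′ = inj₂ (suc x , px , +-mono-≤ (≤-trans (≤-reflexive (*-identityˡ _)) le′) le)
  ...   | inj₂ le′ = inj₂ (zero , eq , +-mono-≤ (≤-reflexive (*-identityˡ _))
                                              (≤-trans le (*-monoʳ-≤ (# (p ∘ suc)) le′)))
... | inj₁ z = contradiction (subst (0 <_) z pos) λ ()
... | inj₂ r = r

∑-pigeonhole-min : (p : Fin n → Bool) (g : Fin n → ℕ) → 0 < # p →
                   ∃ λ x → p x ≡ true × # p * g x ≤ ∑⟨ p ⟩ g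
∑-pigeonhole-min {n} p g pos with go p g
  where
  go : ∀ {n} (p : Fin n → Bool) (g : Fin n → ℕ) →
       # p ≡ 0 ⊎ ∃ λ x → p x ≡ true × # p * g x ≤ ∑⟨ p ⟩ g
  go {zero}  p g = inj₁ refl
  go {suc n} p g with p zero in eq | go (p ∘ suc) (g ∘ suc)
  ... | false | inj₁ z = inj₁ z
  ... | false | inj₂ (x , px , le) = inj₂ (suc x , px , le)
  ... | true  | inj₁ z = inj₂ (zero , eq , +-mono-≤ (≤-reflexive (sym (*-identityˡ (g zero))))
                                                  (≤-trans (≤-reflexive (cong (_* g zero) z)) z≤n))
  ... | true  | inj₂ (x , px , le) with ≤-total (g zero) (g (suc x))
  ...   | inj₁ le′ = inj₂ (zero , eq , +-mono-≤ (≤-reflexive (sym (*-identityˡ _)))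
                                              (≤-trans (*-monoʳ-≤ (# (p ∘ suc)) le′) le))
  ...   | inj₂ le′ = inj₂ (suc x , px , +-mono-≤ (≤-trans le′ (≤-reflexive (sym (*-identityˡ _)))) le)
... | inj₁ z = contradiction (subst (0 <_) z pos) λ ()
... | inj₂ r = r

#≤1 : (p : Fin n → Bool) → (∀ x y → p x ≡ true → p y ≡ true → x ≡ y) → # p ≤ 1
#≤1 p uniq with # p in eq
... | zero = z≤n
... | suc k = subst (_≤ 1) eq (≤-trans
  (#-mono p ⁅ x ⁆ λ y py → dec-true (y Fin.≟ x) (uniq y x py px)) (≤-reflexive (#-singleton x)))
  where
  w : ∃ λ x → p x ≡ true × # p * 0 ≤ ∑⟨ p ⟩ (λ _ → 0)
  -- For the zero function the pigeonhole principle merely selects an element of `p`.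
  w = ∑-pigeonhole-min p (λ _ → 0) (subst (0 <_) (sym eq) (s≤s z≤n))
  x = proj₁ w
  px = proj₁ (proj₂ w)

-- Monochromatic neighbourhoods

n²≤4[n-1]² : ∀ {n} → 2 ≤ n → n * n ≤ 4 * ((n ∸ 1) * (n ∸ 1))
n²≤4[n-1]² {n} 2≤n = begin
  n * n                               ≤⟨ *-mono-≤ le le ⟩
  (2 * (n ∸ 1)) * (2 * (n ∸ 1))       ≡⟨ eq (n ∸ 1) ⟩
  4 * ((n ∸ 1) * (n ∸ 1))             ∎
  where
  open ≤-Reasoning
  eq : ∀ a → (2 * a) * (2 * a) ≡ 4 * (a * a)
  eq = solve-∀
  dbl : ∀ {m} → 2 ≤ m → m ≤ 2 * (m ∸ 1)
  dbl (s≤s (s≤s {n = m} _)) = s≤s (≤-trans (m≤n+m (suc m) m) (≤-reflexive (cong (m +_) (sym (*-identityˡ (suc m))))))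
  le = dbl 2≤n

-- The constant 8 is 4 · 2: a factor 4 for replacing (N - 1)² by N², and a factor 2 for keeping only
-- the larger summand.
larger-half : ∀ {N s t} → 2 ≤ N → ∀ k → (N ∸ 1) * (N ∸ 1) ≤ k * (s + t) → s ≤ t → ∀ p → t ≤ N * p →
              N ≤ (8 * k) * p
larger-half {N} {s} {t} 2≤N k le s≤t p t≤ = *-cancelˡ-≤ N {{>-nonZero (≤-trans (s≤s z≤n) 2≤N)}} (begin
  N * N                      ≤⟨ n²≤4[n-1]² 2≤N ⟩
  4 * ((N ∸ 1) * (N ∸ 1))    ≤⟨ *-monoʳ-≤ 4 le ⟩
  4 * (k * (s + t))          ≤⟨ *-monoʳ-≤ 4 (*-monoʳ-≤ k (+-monoˡ-≤ t s≤t)) ⟩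
  4 * (k * (t + t))          ≤⟨ *-monoʳ-≤ 4 (*-monoʳ-≤ k (+-mono-≤ t≤ t≤)) ⟩
  4 * (k * (N * p + N * p))  ≡⟨ eq k N p ⟩
  N * ((8 * k) * p)          ∎)
  where
  open ≤-Reasoning
  eq : ∀ a b c → 4 * (a * (b * c + b * c)) ≡ b * ((8 * a) * c)
  eq = solve-∀

module _ {n r : ℕ} (col : Fin n → Fin n → Fin r) where

  -- `K` may contain colours that do not occur in `V`; only its size enters the bounds.
  UsesOnly : (Fin n → Bool) → (Fin r → Bool) → Set
  UsesOnly V K = ∀ u v → V u ≡ true → V v ≡ true → u ≢ v → K (col u v) ≡ true

  -- The vertex `w` itself is excluded, since the diagonal value `col w w` is arbitrary.
  nbhd : Fin r → Fin n → Fin n → Bool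
  nbhd i w = ∁ ⁅ w ⁆ ∩ λ u → does (col w u Fin.≟ i)

  nbhd-true : ∀ {i w u} → nbhd i w u ≡ true → w ≢ u × col w u ≡ i
  nbhd-true {i} {w} {u} e =
    (λ w≡u → ∁⁅⁆-true {x = w} {u} (proj₁ (∧-true e)) (sym w≡u)) ,
    does-true (col w u Fin.≟ i) (proj₂ (∧-true {∁ ⁅ w ⁆ u} e))

  common : Fin r → Fin n → Fin n → Fin n → Bool
  common i u v w = nbhd i w u ∧ nbhd i w v

  module _ (V : Fin n → Bool) (K : Fin r → Bool) where

    deg : Fin r → Fin n → ℕ
    deg i w = # (V ∩ nbhd i w)

    -- Every other vertex of `V` is counted at the colour of its edge to `w`, and that colour lies
    -- in `K`.
    degree-sum : UsesOnly V K → ∀ w → V w ≡ true → # V ∸ 1 ≤ ∑⟨ K ⟩ (λ i → deg i w)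
    degree-sum valid w Vw = begin
      # V ∸ 1
        ≡⟨ cong (_∸ 1) (#-split V ⁅ w ⁆) ⟩
      (# (V ∩ ⁅ w ⁆) + # (V ∩ ∁ ⁅ w ⁆)) ∸ 1
        ≤⟨ ∸-monoˡ-≤ 1 (+-monoˡ-≤ (# (V ∩ ∁ ⁅ w ⁆)) (#-∩-singleton V w)) ⟩
      # (V ∩ ∁ ⁅ w ⁆)
        ≡⟨ #-∩ V (∁ ⁅ w ⁆) ⟩
      ∑⟨ V ⟩ (λ u → ⟦ ∁ ⁅ w ⁆ u ⟧)
        ≤⟨ ∑-mono V (λ u Vu → one u Vu) ⟩
      ∑⟨ V ⟩ (λ u → ∑⟨ K ⟩ (λ i → ⟦ nbhd i w u ⟧))
        ≡⟨ ∑-swap V K (λ u i → ⟦ nbhd i w u ⟧) ⟩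
      ∑⟨ K ⟩ (λ i → ∑⟨ V ⟩ (λ u → ⟦ nbhd i w u ⟧))
        ≡⟨ ∑-cong K (λ i → sym (#-∩ V (nbhd i w))) ⟩
      ∑⟨ K ⟩ (λ i → deg i w) ∎
      where
      open ≤-Reasoning
      one : ∀ u → V u ≡ true → ⟦ ∁ ⁅ w ⁆ u ⟧ ≤ ∑⟨ K ⟩ (λ i → ⟦ nbhd i w u ⟧)
      one u Vu = ⟦⟧≤ λ u≠w → ≤-trans (≤-reflexive (sym (tm u≠w)))
                              (term≤sum (λ i → ⟦ K i ⟧ * ⟦ nbhd i w u ⟧) (col w u))
        where
        tm : ∁ ⁅ w ⁆ u ≡ true → ⟦ K (col w u) ⟧ * ⟦ nbhd (col w u) w u ⟧ ≡ 1
        tm u≠w rewrite valid w u Vw Vu (λ w≡u → ∁⁅⁆-true {x = w} {y = u} u≠w (sym w≡u))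
                     | u≠w | dec-true (col w u Fin.≟ col w u) refl = refl

    -- Double counting of the monochromatic paths u – w – v, centred at w.
    cherries : UsesOnly V K → 2 ≤ # V → ∃₂ λ i u → V u ≡ true ×
      (# V ∸ 1) * (# V ∸ 1) ≤ (# K * # K * # K) * ∑⟨ V ⟩ (λ v → # (V ∩ common i u v))
    cherries valid 2≤N = i , u , Vu , *-cancelˡ-≤ N {{>-nonZero (≤-trans (s≤s z≤n) 2≤N)}} (begin
      N * (M * M)                     ≤⟨ step₂ ⟩
      (k * k * k) * S i               ≤⟨ *-monoʳ-≤ (k * k * k) leR ⟩
      (k * k * k) * (N * R i u)       ≡⟨ swap₃ (k * k * k) N (R i u) ⟩
      N * ((k * k * k) * R i u)       ≡⟨ cong (λ z → N * ((k * k * k) * z)) (R≡ i u) ⟩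
      N * ((k * k * k) * ∑⟨ V ⟩ (λ v → # (V ∩ common i u v))) ∎)
      where
      open ≤-Reasoning
      N = # V
      M = # V ∸ 1
      k = # K
      0<M : 0 < M
      0<M = m<n⇒0<n∸m 2≤N
      D² : Fin n → ℕ
      D² w = ∑⟨ K ⟩ (λ i → deg i w * deg i w)
      S : Fin r → ℕ
      S i = ∑⟨ V ⟩ (λ w → deg i w * deg i w)
      R : Fin r → Fin n → ℕ
      R i u = ∑⟨ V ⟩ (λ w → deg i w * ⟦ nbhd i w u ⟧)
      swap₃ : ∀ a b c → a * (b * c) ≡ b * (a * c)
      swap₃ = solve-∀
      sq : ∀ a b → (a * b) * (a * b) ≡ (a * a) * (b * b)
      sq = solve-∀
      -- The largest degree at `w` is at least M/k, and its square alone suffices. This replaces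
      -- Cauchy-Schwarz at the cost of one factor k.
      atCentre : ∀ w → V w ≡ true → M * M ≤ (k * k) * D² w
      atCentre w Vw with ∑-pigeonhole K (λ i → deg i w) (<-≤-trans 0<M (degree-sum valid w Vw))
      ... | i , Ki , le = begin
        M * M                            ≤⟨ *-mono-≤ M≤ M≤ ⟩
        (k * deg i w) * (k * deg i w)    ≡⟨ sq k (deg i w) ⟩
        (k * k) * (deg i w * deg i w)    ≤⟨ *-monoʳ-≤ (k * k) (∈⇒≤∑ K (λ i → deg i w * deg i w) i Ki) ⟩
        (k * k) * D² w                   ∎
        where M≤ = ≤-trans (degree-sum valid w Vw) le
      step₁ : N * (M * M) ≤ (k * k) * ∑⟨ K ⟩ S
      step₁ = begin
        N * (M * M)                       ≤⟨ ∑-≥ V (λ w → (k * k) * D² w) (M * M) atCentre ⟩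
        ∑⟨ V ⟩ (λ w → (k * k) * D² w)     ≡⟨ sym (*-∑ (k * k) V D²) ⟩
        (k * k) * ∑⟨ V ⟩ D²               ≡⟨ cong ((k * k) *_) (∑-swap V K (λ w i → deg i w * deg i w)) ⟩
        (k * k) * ∑⟨ K ⟩ S                ∎
      pos : ∀ {a} b {c} → 0 < a → a ≤ b * c → 0 < c
      pos b {zero}  0<a a≤ = contradiction (<-≤-trans 0<a (≤-trans a≤ (≤-reflexive (*-zeroʳ b)))) λ ()
      pos b {suc c} _   _  = s≤s z≤n
      0<NMM : 0 < N * (M * M)
      0<NMM = *-mono-≤ (≤-trans (s≤s z≤n) 2≤N) (*-mono-≤ 0<M 0<M)
      -- Fixing the most frequent colour costs the third factor k.
      popular = ∑-pigeonhole K S (pos (k * k) 0<NMM step₁)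
      i = proj₁ popular
      step₂ : N * (M * M) ≤ (k * k * k) * S i
      step₂ = ≤-trans step₁ (≤-trans (*-monoʳ-≤ (k * k) (proj₂ (proj₂ popular)))
                                     (≤-reflexive (sym (*-assoc (k * k) k (S i)))))
      -- One factor of the squared degree is expanded over the end `u` of the path; `R≡` expands the
      -- other over `v`.
      S≡ : ∀ i → S i ≡ ∑⟨ V ⟩ (R i)
      S≡ i = trans (∑-cong V (λ w → trans (cong (deg i w *_) (#-∩ V (nbhd i w)))
                                          (*-∑ (deg i w) V (λ u → ⟦ nbhd i w u ⟧))))
                   (∑-swap V V (λ w u → deg i w * ⟦ nbhd i w u ⟧))
      centre = ∑-pigeonhole V (R i) (subst (0 <_) (S≡ i) (pos (k * k * k) 0<NMM step₂))
      u = proj₁ centre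
      Vu = proj₁ (proj₂ centre)
      leR : S i ≤ N * R i u
      leR = subst (_≤ N * R i u) (sym (S≡ i)) (proj₂ (proj₂ centre))
      R≡ : ∀ i u → R i u ≡ ∑⟨ V ⟩ (λ v → # (V ∩ common i u v))
      R≡ i u = trans (∑-cong V eq)
        (trans (∑-swap V V (λ w v → ⟦ nbhd i w u ⟧ * ⟦ nbhd i w v ⟧))
               (∑-cong V (λ v → trans (∑-cong V (λ w → sym (⟦∧⟧ (nbhd i w u) (nbhd i w v))))
                                      (sym (#-∩ V (common i u v))))))
        where
        eq : ∀ w → deg i w * ⟦ nbhd i w u ⟧ ≡ ∑⟨ V ⟩ (λ v → ⟦ nbhd i w u ⟧ * ⟦ nbhd i w v ⟧)
        eq w = trans (*-comm (deg i w) _)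
          (trans (cong (⟦ nbhd i w u ⟧ *_) (#-∩ V (nbhd i w))) (*-∑ ⟦ nbhd i w u ⟧ V _))

    module _ (2≤N : 2 ≤ # V) (near : Fin n → Bool) (i : Fin r) (u : Fin n) where

      private
        k³ = # K * # K * # K
        codeg : Fin n → ℕ
        codeg v = # (V ∩ common i u v)
        A = ∑⟨ V ∩ near ⟩ codeg
        B = ∑⟨ V ∩ ∁ near ⟩ codeg

      -- One of the two parts carries half of the codegree sum. If it is the near part, each
      -- codegree being at most N forces many near vertices; otherwise some far vertex has at least
      -- the average codegree.
      near-or-far : (# V ∸ 1) * (# V ∸ 1) ≤ k³ * ∑⟨ V ⟩ codeg →
        # V ≤ (8 * k³) * # (V ∩ near) ⊎
        ∃ λ v → near v ≡ false × # V ≤ (8 * k³) * # (V ∩ common i u v)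
      near-or-far le = go (≤-total B A) (0 <? B)
        where
        codeg≤N : ∀ v → codeg v ≤ # V
        codeg≤N v = #-mono (V ∩ common i u v) V (λ w → proj₁ ∘ ∧-true)
        le′ : (# V ∸ 1) * (# V ∸ 1) ≤ k³ * (A + B)
        le′ = subst (λ z → (# V ∸ 1) * (# V ∸ 1) ≤ k³ * z) (∑-split V near codeg) le
        near-case : B ≤ A → # V ≤ (8 * k³) * # (V ∩ near)
        near-case B≤A = larger-half 2≤N k³
          (subst (λ z → (# V ∸ 1) * (# V ∸ 1) ≤ k³ * z) (+-comm A B) le′) B≤A (# (V ∩ near))
          (≤-trans (∑-≤ (V ∩ near) codeg (# V) (λ v _ → codeg≤N v)) (≤-reflexive (*-comm (# (V ∩ near)) (# V))))
        far-case : A ≤ B → (∃ λ v → (V ∩ ∁ near) v ≡ true × B ≤ # (V ∩ ∁ near) * codeg v) →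
          ∃ λ v → near v ≡ false × # V ≤ (8 * k³) * codeg v
        far-case A≤B (v , v∈ , B≤) = v , not-true (proj₂ (∧-true {V v} v∈)) ,
          larger-half 2≤N k³ le′ A≤B (codeg v)
            (≤-trans B≤ (*-monoˡ-≤ (codeg v) (#-mono (V ∩ ∁ near) V (λ w → proj₁ ∘ ∧-true))))
        go : (B ≤ A) ⊎ (A ≤ B) → Dec (0 < B) →
             # V ≤ (8 * k³) * # (V ∩ near) ⊎ ∃ λ v → near v ≡ false × # V ≤ (8 * k³) * codeg v
        go (inj₁ B≤A) _         = inj₁ (near-case B≤A)
        -- If B = 0 there need be no far vertex to choose, but then B ≤ A holds as well.
        go (inj₂ _)   (no B≮)   = inj₁ (near-case (≤-trans (≮⇒≥ B≮) z≤n))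
        go (inj₂ A≤B) (yes 0<B) = inj₂ (far-case A≤B (∑-pigeonhole (V ∩ ∁ near) codeg 0<B))

-- Trading vertices for colours

third-colour : (a b c d : Fin 3) → a ≢ b → c ≢ a → c ≢ b → d ≢ a → d ≢ b → c ≡ d
third-colour = from-yes (all? {3} λ a → all? {3} λ b → all? {3} λ c → all? {3} λ d →
  ¬? (a Fin.≟ b) →-dec ¬? (c Fin.≟ a) →-dec ¬? (c Fin.≟ b) →-dec
  ¬? (d Fin.≟ a) →-dec ¬? (d Fin.≟ b) →-dec (c Fin.≟ d))

-- The hypothesis says that at most the fraction e/m ≤ 1/2 of x is lost in passing to y.
halving : ∀ {x y m e} → 0 < m → 2 * e ≤ m → x * m ≤ y * m + e * x → x ≤ 2 * y
halving {x} {y} {m} {e} 0<m 2e≤m le = *-cancelʳ-≤ x (2 * y) m {{>-nonZero 0<m}} (+-cancelʳ-≤ (m * x) (x * m) (2 * y * m) (begin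
  x * m + m * x              ≡⟨ eq₁ x m ⟩
  2 * (x * m)                ≤⟨ *-monoʳ-≤ 2 le ⟩
  2 * (y * m + e * x)        ≡⟨ eq₂ y m e x ⟩
  2 * y * m + 2 * e * x      ≤⟨ +-monoʳ-≤ (2 * y * m) (*-monoˡ-≤ x 2e≤m) ⟩
  2 * y * m + m * x          ∎))
  where
  open ≤-Reasoning
  eq₁ : ∀ x m → x * m + m * x ≡ 2 * (x * m)
  eq₁ = solve-∀
  eq₂ : ∀ y m e x → 2 * (y * m + e * x) ≡ 2 * y * m + 2 * e * x
  eq₂ = solve-∀

module _ {n r : ℕ} (col : Fin n → Fin n → Fin r) (f : Fin r → Fin r → Fin n → Fin 3)
         (proper : ∀ i j u v → u ≢ v → col u v ≡ i ⊎ col u v ≡ j → f i j u ≢ f i j v) where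

  agree : Fin r → Fin n → Fin n → Fin r → Bool
  agree i u v j = does (f i j u Fin.≟ f i j v)

  -- If u and v disagree on f i j, their common i-neighbours all get the third value,
  -- so no edge among them has colour j.
  usesOnly-common : ∀ {V K} → UsesOnly col V K → ∀ i u v →
                    UsesOnly col (V ∩ common col i u v) (K ∩ agree i u v)
  usesOnly-common {V} {K} valid i u v w w′ w∈ w′∈ w≢w′ =
    ∧-true⁺ (valid w w′ (proj₁ (∧-true w∈)) (proj₁ (∧-true w′∈)) w≢w′) (agreed (f i j u Fin.≟ f i j v))
    where
    j = col w w′
    away : ∀ {w} x → nbhd col i w x ≡ true → f i j w ≢ f i j x
    away {w} x e = let (w≢x , wx) = nbhd-true col {i} {w} {x} e in proper i j w x w≢x (inj₁ wx)
    to : ∀ {w} → (V ∩ common col i u v) w ≡ true → nbhd col i w u ≡ true × nbhd col i w v ≡ true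
    to {w} e = ∧-true (proj₂ (∧-true {V w} e))
    agreed : (d : Dec (f i j u ≡ f i j v)) → does d ≡ true
    agreed (yes _) = refl
    agreed (no fu≢fv) = contradiction
      (third-colour _ _ _ _ fu≢fv (away u (proj₁ (to w∈))) (away v (proj₂ (to w∈)))
                                  (away u (proj₁ (to w′∈))) (away v (proj₂ (to w′∈))))
      (proper i j w w′ w≢w′ (inj₂ refl))

  usesOnly-remove : ∀ {V K} → UsesOnly col V K → (j : Fin r) (W : Fin n → Bool) →
    (∀ u v → u ≢ v → W u ≡ true → W v ≡ true → col u v ≢ j) →
    UsesOnly col (V ∩ W) (K ∩ ∁ ⁅ j ⁆)
  usesOnly-remove {V} {K} valid j W free u v u∈ v∈ u≢v =
    ∧-true⁺ {K (col u v)} (valid u v (proj₁ (∧-true {V u} u∈)) (proj₁ (∧-true {V v} v∈)) u≢v)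
            (∁⁅⁆-true⁺ (free u v u≢v (proj₂ (∧-true {V u} u∈)) (proj₂ (∧-true {V v} v∈))))

  independent-class : (W : Fin n → Bool) → ∀ i j → (∀ u v → W u ≡ true → W v ≡ true → f i j u ≡ f i j v) →
                      ∀ u v → u ≢ v → W u ≡ true → W v ≡ true → col u v ≢ j
  independent-class W i j same u v u≢v u∈ v∈ c≡j = proper i j u v u≢v (inj₂ c≡j) (same u v u∈ v∈)

  -- For a colour j of `K`, the largest of the three classes of `f j j` contains no edge of colour
  -- j, so each colour costs a factor 3. Once no colour is left, there is no room for two vertices.
  crude-bound : ∀ k {V K} → UsesOnly col V K → # K ≡ k → # V ≤ 3 ^ k
  crude-bound zero {V} {K} valid #K≡0 = #≤1 V unique
    where
    unique : ∀ x y → V x ≡ true → V y ≡ true → x ≡ y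
    unique x y x∈ y∈ with x Fin.≟ y
    ... | yes x≡y = x≡y
    ... | no x≢y  = contradiction (trans (sym (valid x y x∈ y∈ x≢y)) (#≡0 K #K≡0 (col x y))) λ ()
  crude-bound (suc k) {V} {K} valid #K≡1+k = bound (0 <? # V)
    where
    some-colour = ∑-pigeonhole-min K (λ _ → 0) (subst (0 <_) (sym #K≡1+k) (s≤s z≤n))
    j = proj₁ some-colour
    part : Fin 3 → Fin n → Bool
    part a v = does (f j j v Fin.≟ a)
    all : Fin 3 → Bool
    all _ = true
    cover : # V ≤ ∑⟨ all ⟩ (λ a → # (V ∩ part a))
    cover = begin
      # V                                          ≡⟨ sym (trans (∑-const V 1) (*-identityʳ (# V))) ⟩
      ∑⟨ V ⟩ (λ _ → 1)                             ≤⟨ ∑-mono V (λ v _ → in-part v) ⟩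
      ∑⟨ V ⟩ (λ v → ∑⟨ all ⟩ (λ a → ⟦ part a v ⟧)) ≡⟨ ∑-swap V all (λ v a → ⟦ part a v ⟧) ⟩
      ∑⟨ all ⟩ (λ a → ∑⟨ V ⟩ (λ v → ⟦ part a v ⟧)) ≡⟨ ∑-cong all (λ a → sym (#-∩ V (part a))) ⟩
      ∑⟨ all ⟩ (λ a → # (V ∩ part a))              ∎
      where
      open ≤-Reasoning
      in-part : ∀ v → 1 ≤ ∑⟨ all ⟩ (λ a → ⟦ part a v ⟧)
      in-part v = ≤-trans (≤-reflexive (cong ⟦_⟧ (sym (dec-true (f j j v Fin.≟ f j j v) refl))))
                          (∈⇒≤∑ all (λ a → ⟦ part a v ⟧) (f j j v) refl)
    class-bound : ∀ a → # (V ∩ part a) ≤ 3 ^ k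
    class-bound a = crude-bound k
      (usesOnly-remove {V} {K} valid j (part a) (independent-class (part a) j j λ u v u∈ v∈ →
        trans (does-true (f j j u Fin.≟ a) u∈) (sym (does-true (f j j v Fin.≟ a) v∈))))
      (suc-injective (trans (sym (#-remove K j (proj₁ (proj₂ some-colour)))) #K≡1+k))
    bound : Dec (0 < # V) → # V ≤ 3 ^ suc k
    bound (no ≮)   = ≤-trans (≮⇒≥ ≮) z≤n
    bound (yes 0<) = in-class (∑-pigeonhole all (λ a → # (V ∩ part a)) (<-≤-trans 0< cover))
      where
      in-class : (∃ λ a → all a ≡ true × ∑⟨ all ⟩ (λ a → # (V ∩ part a)) ≤ 3 * # (V ∩ part a)) → # V ≤ 3 ^ suc k
      in-class (a , _ , le) = ≤-trans cover (≤-trans le (*-monoʳ-≤ 3 (class-bound a)))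

  -- The points agree with z on all but at most D of the colourings f i j; this survives
  -- passing to fewer points and fewer colours.
  record Ball (i : Fin r) (z : Fin n) (D : ℕ) : Set where
    field
      points    : Fin n → Bool
      colours   : Fin r → Bool
      valid     : UsesOnly col points colours
      radius    : ∀ v → points v ≡ true → # (colours ∩ ∁ (agree i z v)) ≤ D

  open Ball

  module _ {i : Fin r} {z : Fin n} {D : ℕ} where

    -- The last inequality is |U′| ≥ (1 - bD/m)|U| cleared of denominators, where `m` is a lower
    -- bound for the number of colours present at each removal.
    Shrunk : Ball i z D → (m b : ℕ) → Set
    Shrunk B m b = Σ (Ball i z D) λ B′ →
      # (colours B) ≡ b + # (colours B′) × # (points B′) ≤ # (points B) ×
      # (points B) * m ≤ # (points B′) * m + (b * D) * # (points B)

    -- Each point disagrees with z for at most D colours, so for some colour j at most the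
    -- fraction D/k of the points disagree with z on f i j.
    remove-colour : (B : Ball i z D) → ∀ m → m ≤ # (colours B) → 0 < # (colours B) → Shrunk B m 1
    remove-colour B m m≤k 0<k = B′ , #-remove K j Kj , #-mono U′ U (λ v → proj₁ ∘ ∧-true) , shrink
      where
      U = points B
      K = colours B
      bad : Fin r → ℕ
      bad j = # (U ∩ ∁ (λ v → agree i z v j))
      choice = ∑-pigeonhole-min K bad 0<k
      j = proj₁ choice
      Kj = proj₁ (proj₂ choice)
      good : Fin n → Bool
      good v = agree i z v j
      U′ = U ∩ good
      K′ = K ∩ ∁ ⁅ j ⁆
      B′ : Ball i z D
      B′ = record
        { points  = U′
        ; colours = K′
        ; valid   = usesOnly-remove {U} {K} (valid B) j good (independent-class good i j λ u v u∈ v∈ →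
            trans (sym (does-true (f i j z Fin.≟ f i j u) u∈)) (does-true (f i j z Fin.≟ f i j v) v∈))
        ; radius  = λ v v∈ → ≤-trans
            (#-mono (K′ ∩ ∁ (agree i z v)) (K ∩ ∁ (agree i z v)) λ l l∈ →
              ∧-true⁺ (proj₁ (∧-true (proj₁ (∧-true l∈)))) (proj₂ (∧-true {K′ l} l∈)))
            (radius B v (proj₁ (∧-true v∈)))
        }
      -- Disagreeing pairs of a colour and a point are counted from the side of the points, where
      -- `radius` bounds them.
      bad-total : ∑⟨ K ⟩ bad ≤ # U * D
      bad-total = begin
        ∑⟨ K ⟩ bad
          ≡⟨ ∑-cong K (λ j → #-∩ U (∁ (λ v → agree i z v j))) ⟩
        ∑⟨ K ⟩ (λ j → ∑⟨ U ⟩ (λ v → ⟦ ∁ (agree i z v) j ⟧))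
          ≡⟨ ∑-swap K U (λ j v → ⟦ ∁ (agree i z v) j ⟧) ⟩
        ∑⟨ U ⟩ (λ v → ∑⟨ K ⟩ (λ j → ⟦ ∁ (agree i z v) j ⟧))
          ≤⟨ ∑-≤ U _ D (λ v v∈ → subst (_≤ D) (#-∩ K (∁ (agree i z v))) (radius B v v∈)) ⟩
        # U * D ∎
        where open ≤-Reasoning
      shrink : # U * m ≤ # U′ * m + (1 * D) * # U
      shrink = begin
        # U * m                    ≡⟨ cong (_* m) (#-split U good) ⟩
        (# U′ + bad j) * m         ≡⟨ *-distribʳ-+ m (# U′) (bad j) ⟩
        # U′ * m + bad j * m       ≤⟨ +-monoʳ-≤ (# U′ * m) (*-monoʳ-≤ (bad j) m≤k) ⟩
        # U′ * m + bad j * # K     ≡⟨ cong (# U′ * m +_) (*-comm (bad j) (# K)) ⟩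
        # U′ * m + # K * bad j     ≤⟨ +-monoʳ-≤ (# U′ * m) (≤-trans (proj₂ (proj₂ choice)) bad-total) ⟩
        # U′ * m + # U * D         ≡⟨ cong (# U′ * m +_) (*-comm (# U) D) ⟩
        # U′ * m + D * # U         ≡⟨ cong (λ e → # U′ * m + e * # U) (sym (*-identityˡ D)) ⟩
        # U′ * m + (1 * D) * # U   ∎
        where open ≤-Reasoning

    -- Each removal loses at most the fraction D/m of the current points, hence of the initial ones,
    -- so the losses simply add up.
    remove-batch : ∀ b (B : Ball i z D) m → 0 < m → b + m ≤ # (colours B) → Shrunk B m b
    remove-batch zero    B m 0<m le = B , refl , ≤-refl , ≤-reflexive (sym (+-identityʳ _))
    remove-batch (suc b) B m 0<m le =
      after (remove-colour B m (≤-trans (m≤n+m m (suc b)) le) (<-≤-trans (s≤s z≤n) le))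
      where
      after : Shrunk B m 1 → Shrunk B m (suc b)
      after (B₁ , eq₁ , sub₁ , le₁) = rest (remove-batch b B₁ m 0<m (≤-pred (subst (suc b + m ≤_) eq₁ le)))
        where
        p = # (points B)
        p₁ = # (points B₁)
        rest : Shrunk B₁ m b → Shrunk B m (suc b)
        rest (B₂ , eq₂ , sub₂ , le₂) = B₂ , trans eq₁ (cong suc eq₂) , ≤-trans sub₂ sub₁ , (begin
          p * m                                     ≤⟨ le₁ ⟩
          p₁ * m + (1 * D) * p                      ≤⟨ +-monoˡ-≤ ((1 * D) * p) le₂ ⟩
          p₂ * m + (b * D) * p₁ + (1 * D) * p       ≤⟨ +-monoˡ-≤ ((1 * D) * p)
                                                         (+-monoʳ-≤ (p₂ * m) (*-monoʳ-≤ (b * D) sub₁)) ⟩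
          p₂ * m + (b * D) * p + (1 * D) * p        ≡⟨ eq (p₂ * m) b D p ⟩
          p₂ * m + ((1 + b) * D) * p                ∎)
          where
          open ≤-Reasoning
          p₂ = # (points B₂)
          eq : ∀ w b D p → w + (b * D) * p + (1 * D) * p ≡ w + ((1 + b) * D) * p
          eq = solve-∀

    Halved : Ball i z D → (t b : ℕ) → Set
    Halved B t b = Σ (Ball i z D) λ B′ →
      # (colours B) ≡ t * b + # (colours B′) × # (points B) ≤ 2 ^ t * # (points B′)

    -- Since bD/m ≤ 1/2, a whole batch of `b` colours at most halves the number of points.
    remove-batches : ∀ t b (B : Ball i z D) m → 0 < m → 2 * (b * D) ≤ m → t * b + m ≤ # (colours B) →
                     Halved B t b
    remove-batches zero    b B m 0<m 2bD≤m le = B , refl , ≤-reflexive (sym (*-identityˡ _))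
    remove-batches (suc t) b B m 0<m 2bD≤m le =
      after (remove-batch b B m 0<m (≤-trans (+-monoˡ-≤ m (m≤m+n b (t * b))) le))
      where
      after : Shrunk B m b → Halved B (suc t) b
      after (B₁ , eq₁ , _ , le₁) = rest (remove-batches t b B₁ m 0<m 2bD≤m
          (+-cancelˡ-≤ b _ _ (subst₂ _≤_ (+-assoc b (t * b) m) eq₁ le)))
        where
        rest : Halved B₁ t b → Halved B (suc t) b
        rest (B₂ , eq₂ , le₂) = B₂ , trans eq₁ (trans (cong (b +_) eq₂) (sym (+-assoc b (t * b) _))) ,
          ≤-trans (halving {# (points B)} {# (points B₁)} {m} {b * D} 0<m 2bD≤m le₁)
                  (≤-trans (*-monoʳ-≤ 2 le₂) (≤-reflexive (sym (*-assoc 2 (2 ^ t) _))))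

  Reduced : (Fin n → Bool) → (Fin r → Bool) → (D t : ℕ) → Set
  Reduced V K D t = ∃₂ λ V′ K′ → UsesOnly col V′ K′ × D + # K′ ≤ # K ×
    # V ≤ (8 * (# K * # K * # K)) * (2 ^ t * # V′)

  -- Many near vertices form a ball around `u`, from which `t` batches are removed. A far vertex of
  -- large codegree gets rid of the `D` colours at once.
  reduce : ∀ {V K} → UsesOnly col V K → 2 ≤ # V → ∀ D t b m → 0 < m →
           2 * (b * D) ≤ m → D ≤ t * b → t * b + m ≤ # K → Reduced V K D t
  reduce {V} {K} valid 2≤N D t b m 0<m 2bD≤m D≤tb tb+m≤k = split (cherries col V K valid 2≤N)
    where
    k³ = # K * # K * # K
    codegrees : Fin r → Fin n → ℕ
    codegrees i u = ∑⟨ V ⟩ (λ v → # (V ∩ common col i u v))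
    close? : ∀ i u v → Dec (# (K ∩ ∁ (agree i u v)) < D)
    close? i u v = # (K ∩ ∁ (agree i u v)) <? D
    split : (∃₂ λ i u → V u ≡ true × (# V ∸ 1) * (# V ∸ 1) ≤ k³ * codegrees i u) → Reduced V K D t
    split (i , u , _ , le) = cases (near-or-far col V K 2≤N near i u le)
      where
      near : Fin n → Bool
      near v = does (close? i u v)
      start : Ball i u D
      start = record
        { points  = V ∩ near
        ; colours = K
        ; valid   = λ v w v∈ w∈ → valid v w (proj₁ (∧-true v∈)) (proj₁ (∧-true w∈))
        ; radius  = λ v v∈ → <⇒≤ (does-true (close? i u v) (proj₂ (∧-true {V v} v∈)))
        }
      cases : # V ≤ (8 * k³) * # (V ∩ near) ⊎
              (∃ λ v → near v ≡ false × # V ≤ (8 * k³) * # (V ∩ common col i u v)) → Reduced V K D t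
      cases (inj₁ dense) = done (remove-batches t b start m 0<m 2bD≤m tb+m≤k)
        where
        done : Halved start t b → Reduced V K D t
        done (B , eq , le′) = points B , colours B , Ball.valid B ,
          subst (D + # (colours B) ≤_) (sym eq) (+-monoˡ-≤ _ D≤tb) ,
          ≤-trans dense (*-monoʳ-≤ (8 * k³) le′)
      cases (inj₂ (v , far , dense)) =
        V ∩ common col i u v , K ∩ agree i u v , usesOnly-common {V} {K} valid i u v ,
        (begin
          D + # (K ∩ agree i u v)                         ≤⟨ +-monoˡ-≤ _ (≮⇒≥ (does-false (close? i u v) far)) ⟩
          # (K ∩ ∁ (agree i u v)) + # (K ∩ agree i u v)   ≡⟨ +-comm (# (K ∩ ∁ (agree i u v))) _ ⟩
          # (K ∩ agree i u v) + # (K ∩ ∁ (agree i u v))   ≡⟨ sym (#-split K (agree i u v)) ⟩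
          # K                                             ∎) ,
        -- No halving takes place here; the factor 2^t only gives both cases the same bound.
        ≤-trans dense (*-monoʳ-≤ (8 * k³) (m≤n*m _ (2 ^ t) {{m^n≢0 2 t}}))
        where open ≤-Reasoning

-- Iterating the reduction

3^n≤2^2n : ∀ n → 3 ^ n ≤ 2 ^ (2 * n)
3^n≤2^2n n = ≤-trans (^-monoˡ-≤ n (≤ᵇ⇒≤ 3 4 _)) (≤-reflexive (^-*-assoc 2 2 n))

-- The number of colours removed at the price of halving, when there are between a²L and (a + 1)²L.
batch : ℕ → ℕ
batch a = a / 32 + 1

-- Multiplied by L: 64L batches cover the (2a + 1)L colours between a²L and (a + 1)²L.
2a+1≤64batch : ∀ a → 2 * a + 1 ≤ 64 * batch a
2a+1≤64batch a = begin
  2 * a + 1                              ≡⟨ cong (λ z → 2 * z + 1) (m≡m%n+[m/n]*n a 32) ⟩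
  2 * (a % 32 + q * 32) + 1              ≤⟨ +-monoˡ-≤ 1 (*-monoʳ-≤ 2 (+-monoˡ-≤ (q * 32)
                                              (<⇒≤pred (m%n<n a 32)))) ⟩
  2 * (31 + q * 32) + 1                  ≤⟨ n≤1+n _ ⟩
  1 + (2 * (31 + q * 32) + 1)            ≡⟨ eq q ⟩
  64 * (q + 1)                           ∎
  where
  open ≤-Reasoning
  q = a / 32
  eq : ∀ q → 1 + (2 * (31 + q * 32) + 1) ≡ 64 * (q + 1)
  eq = solve-∀

-- From a = 32 on, the 1 added in `batch` is at most a/32.
16batch≤ : ∀ h → 16 * batch (32 + h) ≤ 32 + h
16batch≤ h = *-cancelˡ-≤ 2 (begin
  2 * (16 * (q + 1))      ≡⟨ eq q ⟩
  q * 32 + 32             ≤⟨ +-monoˡ-≤ 32 (m/n*n≤m (32 + h) 32) ⟩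
  32 + h + 32             ≤⟨ +-monoʳ-≤ (32 + h) (m≤m+n 32 h) ⟩
  32 + h + (32 + h)       ≡⟨ cong (32 + h +_) (sym (*-identityˡ (32 + h))) ⟩
  2 * (32 + h)            ∎)
  where
  open ≤-Reasoning
  q = (32 + h) / 32
  eq : ∀ q → 2 * (16 * (q + 1)) ≡ q * 32 + 32
  eq = solve-∀

-- With m = 2bD, this provides the room that `reduce` demands: after 64L batches there remain at
-- least m of more than a²L colours.
batches-fit : ∀ L h → let a = 32 + h in
  64 * L * batch a + 2 * (batch a * ((2 * a + 1) * L)) ≤ a * a * L
batches-fit L h = begin
  64 * L * b + 2 * (b * ((2 * a + 1) * L))   ≡⟨ eq L b a ⟩
  b * (66 + 4 * a) * L                       ≤⟨ *-monoˡ-≤ L (*-monoʳ-≤ b 66+4a≤16a) ⟩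
  b * (16 * a) * L                           ≡⟨ eq₂ L b a ⟩
  (16 * b) * a * L                           ≤⟨ *-monoˡ-≤ L (*-monoˡ-≤ a (16batch≤ h)) ⟩
  a * a * L                                  ∎
  where
  open ≤-Reasoning
  a = 32 + h
  b = batch a
  eq : ∀ L b a → 64 * L * b + 2 * (b * ((2 * a + 1) * L)) ≡ b * (66 + 4 * a) * L
  eq = solve-∀
  eq₂ : ∀ L b a → b * (16 * a) * L ≡ (16 * b) * a * L
  eq₂ = solve-∀
  eq₃ : ∀ h → 318 + 12 * h + (66 + 4 * (32 + h)) ≡ 16 * (32 + h)
  eq₃ = solve-∀
  66+4a≤16a : 66 + 4 * a ≤ 16 * a
  66+4a≤16a = subst (66 + 4 * a ≤_) (eq₃ h) (m≤n+m (66 + 4 * a) (318 + 12 * h))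

8k³≤2^6L : ∀ {k L} → 1 ≤ L → k ≤ 2 ^ L → 8 * (k * k * k) ≤ 2 ^ (6 * L)
8k³≤2^6L {k} {L} 1≤L k≤ = begin
  8 * (k * k * k)                            ≤⟨ *-mono-≤ (^-monoʳ-≤ 2 (*-monoʳ-≤ 3 1≤L))
                                                  (*-mono-≤ (*-mono-≤ k≤ k≤) k≤) ⟩
  2 ^ (3 * L) * (2 ^ L * 2 ^ L * 2 ^ L)      ≡⟨ cong (λ z → 2 ^ (3 * L) * (z * 2 ^ L)) (sym (^-distribˡ-+-* 2 L L)) ⟩
  2 ^ (3 * L) * (2 ^ (L + L) * 2 ^ L)        ≡⟨ cong (2 ^ (3 * L) *_) (sym (^-distribˡ-+-* 2 (L + L) L)) ⟩
  2 ^ (3 * L) * 2 ^ (L + L + L)              ≡⟨ sym (^-distribˡ-+-* 2 (3 * L) (L + L + L)) ⟩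
  2 ^ (3 * L + (L + L + L))                  ≡⟨ cong (2 ^_) (eq L) ⟩
  2 ^ (6 * L)                                ∎
  where
  open ≤-Reasoning
  eq : ∀ L → 3 * L + (L + L + L) ≡ 6 * L
  eq = solve-∀

module _ {n r : ℕ} (col : Fin n → Fin n → Fin r) (f : Fin r → Fin r → Fin n → Fin 3)
         (proper : ∀ i j u v → u ≢ v → col u v ≡ i ⊎ col u v ≡ j → f i j u ≢ f i j v)
         (L : ℕ) (1≤L : 1 ≤ L) (r≤2^L : r ≤ 2 ^ L) where

  -- Passing from (a + 1)²L to a²L colours costs 8k³ ≤ 2^(6L) and 64L halvings.
  size-bound : ∀ h V K → UsesOnly col V K → # K ≤ (32 + h) * (32 + h) * L →
               # V ≤ 2 ^ (70 * ((32 + h) * L))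
  -- With at most 32²L colours the crude bound has exponent 2048L, and 70 · 32 = 2240.
  size-bound zero V K valid k≤ = begin
    # V                     ≤⟨ crude-bound col f proper (# K) valid refl ⟩
    3 ^ # K                 ≤⟨ 3^n≤2^2n (# K) ⟩
    2 ^ (2 * # K)           ≤⟨ ^-monoʳ-≤ 2 (*-monoʳ-≤ 2 k≤) ⟩
    2 ^ (2 * (32 * 32 * L)) ≤⟨ ^-monoʳ-≤ 2 (subst₂ _≤_ (eq₁ L) (eq₂ L) (*-monoˡ-≤ L (≤ᵇ⇒≤ 2048 2240 _))) ⟩
    2 ^ (70 * (32 * L))     ∎
    where
    open ≤-Reasoning
    eq₁ : ∀ L → 2048 * L ≡ 2 * (32 * 32 * L)
    eq₁ = solve-∀
    eq₂ : ∀ L → 2240 * L ≡ 70 * (32 * L)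
    eq₂ = solve-∀
  size-bound (suc h) V K valid k≤ = cases (2 ≤? # V) (# K ≤? a * a * L)
    where
    open ≤-Reasoning
    a = 32 + h
    b = batch a
    D = (2 * a + 1) * L
    0<m : 0 < 2 * (b * D)
    0<m = *-mono-≤ (≤ᵇ⇒≤ 1 2 _) (*-mono-≤ (m≤n+m 1 (a / 32)) (*-mono-≤ (m≤n+m 1 (2 * a)) 1≤L))
    D≤tb : D ≤ 64 * L * b
    D≤tb = ≤-trans (*-monoˡ-≤ L (2a+1≤64batch a)) (≤-reflexive (eq b L))
      where
      eq : ∀ b L → 64 * b * L ≡ 64 * L * b
      eq = solve-∀
    smaller : ∀ V′ K′ → UsesOnly col V′ K′ → # K′ ≤ a * a * L → # V′ ≤ 2 ^ (70 * (a * L))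
    smaller = size-bound h
    step : Reduced col f proper V K D (64 * L) → # V ≤ 2 ^ (70 * ((1 + a) * L))
    step (V′ , K′ , valid′ , k′≤ , N≤) = begin
      # V
        ≤⟨ N≤ ⟩
      (8 * (# K * # K * # K)) * (2 ^ (64 * L) * # V′)
        ≤⟨ *-mono-≤ (8k³≤2^6L 1≤L (≤-trans (#≤n K) r≤2^L))
                    (*-monoʳ-≤ (2 ^ (64 * L)) (smaller V′ K′ valid′ fewer)) ⟩
      2 ^ (6 * L) * (2 ^ (64 * L) * 2 ^ (70 * (a * L)))
        ≡⟨ cong (2 ^ (6 * L) *_) (sym (^-distribˡ-+-* 2 (64 * L) (70 * (a * L)))) ⟩
      2 ^ (6 * L) * 2 ^ (64 * L + 70 * (a * L))
        ≡⟨ sym (^-distribˡ-+-* 2 (6 * L) (64 * L + 70 * (a * L))) ⟩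
      2 ^ (6 * L + (64 * L + 70 * (a * L)))
        -- The constant 70 is 6 + 64.
        ≡⟨ cong (2 ^_) (eq a L) ⟩
      2 ^ (70 * ((1 + a) * L)) ∎
      where
      eq : ∀ a L → 6 * L + (64 * L + 70 * (a * L)) ≡ 70 * ((1 + a) * L)
      eq = solve-∀
      sq : ∀ a L → (1 + a) * (1 + a) * L ≡ (2 * a + 1) * L + a * a * L
      sq = solve-∀
      fewer : # K′ ≤ a * a * L
      fewer = +-cancelˡ-≤ D (# K′) (a * a * L) (≤-trans k′≤ (≤-trans k≤ (≤-reflexive (sq a L))))
    cases : Dec (2 ≤ # V) → Dec (# K ≤ a * a * L) → # V ≤ 2 ^ (70 * ((1 + a) * L))
    cases (no N<2) _ = ≤-trans (≤-pred (≰⇒> N<2)) (m^n>0 2 (70 * ((1 + a) * L)))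
    cases (yes _) (yes k≤′) = ≤-trans (smaller V K valid k≤′)
      (^-monoʳ-≤ 2 (*-monoʳ-≤ 70 (*-monoˡ-≤ L (n≤1+n a))))
    cases (yes 2≤N) (no k≰) = step (reduce col f proper valid 2≤N D (64 * L) b (2 * (b * D))
      0<m ≤-refl D≤tb (≤-trans (batches-fit L h) (<⇒≤ (≰⇒> k≰))))

  order-bound : ∀ h → r ≤ (32 + h) * (32 + h) * L → n ≤ 2 ^ (70 * ((32 + h) * L))
  order-bound h r≤ = subst (_≤ 2 ^ (70 * ((32 + h) * L))) (#-full all (λ _ → refl))
    (size-bound h all (λ _ → true) (λ _ _ _ _ _ → refl) (≤-trans (#≤n _) r≤))
    where
    all : Fin n → Bool
    all _ = true

-- Choosing the parameters in terms of r

floor-log₂ : ∀ r → 1 ≤ r → ∃ λ ℓ → 2 ^ ℓ ≤ r × r < 2 ^ suc ℓ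
floor-log₂ (suc zero)    _ = 0 , ≤-refl , ≤-refl
floor-log₂ (suc (suc r)) _ with floor-log₂ (suc r) (s≤s z≤n)
... | ℓ , lo , hi with suc (suc r) <? 2 ^ suc ℓ
...   | yes hi′ = ℓ , m≤n⇒m≤1+n lo , hi′
...   | no ≮    = suc ℓ , ≮⇒≥ ≮ , ≤-<-trans hi (^-monoʳ-< 2 (s≤s (s≤s z≤n)) {suc ℓ} {suc (suc ℓ)} ≤-refl)

^-cancelˡ-< : ∀ {a b} → 2 ^ a < 2 ^ b → a < b
^-cancelˡ-< {a} {b} lt = ≰⇒> λ b≤a → <⇒≱ lt (^-monoʳ-≤ 2 b≤a)

suc≤2^ : ∀ j → suc j ≤ 2 ^ j
suc≤2^ zero    = ≤-refl
suc≤2^ (suc j) = ≤-trans (+-mono-≤ (m^n>0 2 j) (suc≤2^ j))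
                         (≤-reflexive (cong (2 ^ j +_) (sym (+-identityʳ (2 ^ j)))))

square-bracket : ∀ {r L} → 0 < r → ∀ g → r ≤ g * g * L → ∃ λ h → h * h * L < r × r ≤ suc h * suc h * L
square-bracket 0<r zero r≤ = contradiction (<-≤-trans 0<r r≤) λ ()
square-bracket {r} {L} 0<r (suc g) r≤ with r ≤? g * g * L
... | yes r≤′ = square-bracket 0<r g r≤′
... | no r≰   = g , ≰⇒> r≰ , r≤

-- Rounding r up to the next value of g²L costs at most a factor 2.
next-square : ∀ j → suc (32 + j) * suc (32 + j) ≤ 2 * ((32 + j) * (32 + j))
next-square j = subst (suc (32 + j) * suc (32 + j) ≤_) (eq j)
                      (m≤m+n (suc (32 + j) * suc (32 + j)) (959 + 62 * j + j * j))
  where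
  eq : ∀ j → suc (32 + j) * suc (32 + j) + (959 + 62 * j + j * j) ≡ 2 * ((32 + j) * (32 + j))
  eq = solve-∀

-- The source of the threshold 2^14: 1024 · 15 = 15360 is below 2^14 = 16384. It ensures that r
-- exceeds 32²L, where the iteration ends.
1024[1+ℓ]<2^ℓ : ∀ {ℓ} → 14 ≤ ℓ → 1024 * suc ℓ < 2 ^ ℓ
1024[1+ℓ]<2^ℓ {ℓ} 14≤ℓ = subst (λ ℓ → 1024 * suc ℓ < 2 ^ ℓ) (m+[n∸m]≡n 14≤ℓ) (bound (ℓ ∸ 14))
  where
  open ≤-Reasoning
  eq₁ : ∀ j → 1023 + 15360 * j + suc (1024 * suc (14 + j)) ≡ 16384 * suc j
  eq₁ = solve-∀
  bound : ∀ j → 1024 * suc (14 + j) < 2 ^ (14 + j)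
  bound j = begin
    suc (1024 * suc (14 + j))                      ≤⟨ m≤n+m _ (1023 + 15360 * j) ⟩
    1023 + 15360 * j + suc (1024 * suc (14 + j))   ≡⟨ eq₁ j ⟩
    16384 * suc j                                  ≤⟨ *-monoʳ-≤ 16384 (suc≤2^ j) ⟩
    16384 * 2 ^ j                                  ≡⟨ sym (^-distribˡ-+-* 2 14 j) ⟩
    2 ^ (14 + j)                                   ∎

-- This is 71gL ≤ 130√(rℓ) in squared form, with L = ℓ + 1. The gap between 2 · 71² = 10082 and 130²
-- = 16900 absorbs the difference between L and ℓ.
exponent-bound : ∀ {r g ℓ} → 14 ≤ ℓ → g * g * suc ℓ ≤ 2 * r →
  (71 * (g * suc ℓ)) * (71 * (g * suc ℓ)) ≤ 130 * 130 * (r * ℓ)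
exponent-bound {r} {g} {ℓ} 14≤ℓ g²L≤2r = begin
  (71 * (g * suc ℓ)) * (71 * (g * suc ℓ))   ≡⟨ eq₁ g ℓ ⟩
  5041 * ((g * g * suc ℓ) * suc ℓ)          ≤⟨ *-monoʳ-≤ 5041 (*-monoˡ-≤ (suc ℓ) g²L≤2r) ⟩
  5041 * (2 * r * suc ℓ)                    ≡⟨ eq₂ r ℓ ⟩
  r * (10082 + 10082 * ℓ)                   ≤⟨ *-monoʳ-≤ r (+-monoˡ-≤ (10082 * ℓ) 10082≤) ⟩
  r * (6818 * ℓ + 10082 * ℓ)                ≡⟨ eq₃ r ℓ ⟩
  16900 * (r * ℓ)                           ∎
  where
  open ≤-Reasoning
  eq₁ : ∀ g ℓ → (71 * (g * suc ℓ)) * (71 * (g * suc ℓ)) ≡ 5041 * ((g * g * suc ℓ) * suc ℓ)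
  eq₁ = solve-∀
  eq₂ : ∀ r ℓ → 5041 * (2 * r * suc ℓ) ≡ r * (10082 + 10082 * ℓ)
  eq₂ = solve-∀
  eq₃ : ∀ r ℓ → r * (6818 * ℓ + 10082 * ℓ) ≡ 16900 * (r * ℓ)
  eq₃ = solve-∀
  10082≤ : 10082 ≤ 6818 * ℓ
  10082≤ = ≤-trans (≤ᵇ⇒≤ 10082 (6818 * 14) _) (*-monoʳ-≤ 6818 14≤ℓ)

parameters : ∀ {r ℓ} → 14 ≤ ℓ → 2 ^ ℓ ≤ r → ∃ λ h → r ≤ (32 + h) * (32 + h) * suc ℓ ×
  (71 * ((32 + h) * suc ℓ)) * (71 * ((32 + h) * suc ℓ)) ≤ 130 * 130 * (r * ℓ)
parameters {r} {ℓ} 14≤ℓ lo = choose (square-bracket {r} {suc ℓ} 0<r r r≤r²L)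
  where
  0<r : 0 < r
  0<r = ≤-trans (m^n>0 2 ℓ) lo
  r≤r²L : r ≤ r * r * suc ℓ
  r≤r²L = ≤-trans (m≤m*n r r {{>-nonZero 0<r}}) (m≤m*n (r * r) (suc ℓ))
  Goal = ∃ λ h → r ≤ (32 + h) * (32 + h) * suc ℓ ×
    (71 * ((32 + h) * suc ℓ)) * (71 * ((32 + h) * suc ℓ)) ≤ 130 * 130 * (r * ℓ)
  choose : (∃ λ h → h * h * suc ℓ < r × r ≤ suc h * suc h * suc ℓ) → Goal
  choose (h , small , large) = finish (h ∸ 32) (m+[n∸m]≡n 32≤h)
    where
    32≤h : 32 ≤ h
    32≤h = ≮⇒≥ λ h<32 → <⇒≱ (<-≤-trans (1024[1+ℓ]<2^ℓ 14≤ℓ) lo)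
      (≤-trans large (*-monoˡ-≤ (suc ℓ) (*-mono-≤ h<32 h<32)))
    finish : ∀ j → 32 + j ≡ h → Goal
    -- The upper end h + 1 of the bracket is taken, hence `suc j`.
    finish j refl = suc j , subst (λ z → r ≤ z * z * suc ℓ) (sym (+-suc 32 j)) large ,
      exponent-bound {r} {32 + suc j} {ℓ} 14≤ℓ (begin
        (32 + suc j) * (32 + suc j) * suc ℓ        ≡⟨ cong (λ z → z * z * suc ℓ) (+-suc 32 j) ⟩
        suc (32 + j) * suc (32 + j) * suc ℓ        ≤⟨ *-monoˡ-≤ (suc ℓ) (next-square j) ⟩
        2 * ((32 + j) * (32 + j)) * suc ℓ          ≡⟨ *-assoc 2 ((32 + j) * (32 + j)) (suc ℓ) ⟩
        2 * ((32 + j) * (32 + j) * suc ℓ)          ≤⟨ *-monoʳ-≤ 2 (<⇒≤ small) ⟩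
        2 * r                                      ∎)
      where open ≤-Reasoning

-- The colouring for the lower bound

ThreeColourable : ∀ {n r} → (Fin n → Fin n → Fin r) → Fin r → Fin r → Set
ThreeColourable {n} col i j =
  Σ (Fin n → Fin 3) λ f → ∀ u v → u ≢ v → col u v ≡ i ⊎ col u v ≡ j → f u ≢ f v

-- A colour is a pair (p , S) of a value and a set of coordinates, and a point x is marked by
-- it if its coordinate i = index S equals p; an edge of this colour joins a marked point to
-- an unmarked one.  For colours (p , S) and (p′ , S′) with coordinates i and i′, the first two
-- arguments of paint tell whether i′ ∈ S and i ∈ S′, the last two whether the point is marked
-- by each.  If i′ ∈ S then the ends of an edge of the first colour differ in i′, so they are
-- not both marked by the second; if i′ ∉ S then they agree in i′.
paint : Bool → Bool → Bool → Bool → Fin 3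
paint true  _     qa qb = if qb then zero else if qa then suc zero else suc (suc zero)
paint false true  qa qb = if qa then zero else if qb then suc zero else suc (suc zero)
paint false false qa qb = if qa xor qb then zero else suc zero

compatible : Bool → Bool → Bool → Bool
compatible true  q q′ = not (q ∧ q′)
compatible false q q′ = not (q xor q′)

-- An edge of the first colour flips the first mark, while `compatible` restricts the second; the
-- cases not listed violate it.
paint-first : ∀ s s′ qa qb qb′ → compatible s qb qb′ ≡ true → paint s s′ qa qb ≢ paint s s′ (not qa) qb′
paint-first true  _     true  true  false _ ()
paint-first true  _     false true  false _ ()
paint-first true  _     true  false true  _ ()
paint-first true  _     false false true  _ ()
paint-first true  _     true  false false _ ()
paint-first true  _     false false false _ ()
paint-first false true  true  true  true  _ ()
paint-first false true  true  false false _ ()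
paint-first false true  false true  true  _ ()
paint-first false true  false false false _ ()
paint-first false false true  true  true  _ ()
paint-first false false true  false false _ ()
paint-first false false false true  true  _ ()
paint-first false false false false false _ ()

paint-second : ∀ s s′ qa qa′ qb → compatible s′ qa qa′ ≡ true → paint s s′ qa qb ≢ paint s s′ qa′ (not qb)
paint-second true  _     true  true  true  _ ()
paint-second true  _     true  false true  _ ()
paint-second true  _     false true  true  _ ()
paint-second true  _     false false true  _ ()
paint-second true  _     true  true  false _ ()
paint-second true  _     true  false false _ ()
paint-second true  _     false true  false _ ()
paint-second true  _     false false false _ ()
paint-second false true  true  false true  _ ()
paint-second false true  true  false false _ ()
paint-second false true  false true  true  _ ()
paint-second false true  false true  false _ ()
paint-second false true  false false true  _ ()
paint-second false true  false false false _ ()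
paint-second false false true  true  true  _ ()
paint-second false false true  true  false _ ()
paint-second false false false false true  _ ()
paint-second false false false false false _ ()

module _ (s : ℕ) where

  private
    -- Being positive, `t` leaves a default coordinate for the empty set. There are as many values
    -- as sets of coordinates.
    t = suc s
    m = 2 ^ t

  open Min (Finₚ.≤-totalOrder m) using (_⊓_) renaming (⊓-comm to min-comm; ⊓-sel to min-sel)

  Point : Set
  Point = Fin t → Fin m

  -- The truth value tells whether two coordinates are equal, so the digit 1 marks a difference.
  bit : Bool → Fin 2
  bit true  = zero
  bit false = suc zero

  differences : Point → Point → Fin (2 ^ t)
  differences x y = funToFin (λ j → bit (does (x j Fin.≟ y j)))

  differs? : Fin (2 ^ t) → Fin t → Bool
  differs? S j = does (finToFun {2} {t} S j Fin.≟ suc zero)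

  -- The choice of an element of S; the value for S = ∅ is irrelevant.
  index : Fin (2 ^ t) → Fin t
  index S with any? (λ j → finToFun {2} {t} S j Fin.≟ suc zero)
  ... | yes (j , _) = j
  ... | no _        = zero

  key : Point → Point → Fin m × Fin (2 ^ t)
  key x y = let S = differences x y in x (index S) ⊓ y (index S) , S

  differs?-differences : ∀ x y j → differs? (differences x y) j ≡ not (does (x j Fin.≟ y j))
  differs?-differences x y j
    rewrite finToFun-funToFin (λ j → bit (does (x j Fin.≟ y j))) j with does (x j Fin.≟ y j)
  ... | true  = refl
  ... | false = refl

  index-differs : ∀ x y → (∃ λ j → x j ≢ y j) → x (index (differences x y)) ≢ y (index (differences x y))
  index-differs x y (j , xj≢yj) with any? (λ j → finToFun {2} {t} (differences x y) j Fin.≟ suc zero)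
  ... | no none = contradiction (j , trans (finToFun-funToFin (λ j → bit (does (x j Fin.≟ y j))) j)
                                           (cong bit (dec-false (x j Fin.≟ y j) xj≢yj))) none
  ... | yes (k , eq) = λ xk≡yk → contradiction
    (trans (sym eq) (trans (finToFun-funToFin (λ j → bit (does (x j Fin.≟ y j))) k)
                           (cong bit (dec-true (x k Fin.≟ y k) xk≡yk)))) λ ()

  funToFin-cong : ∀ {a b} {f g : Fin a → Fin b} → (∀ i → f i ≡ g i) → funToFin f ≡ funToFin g
  funToFin-cong {zero}  f≗g = refl
  funToFin-cong {suc a} f≗g = cong₂ combine (f≗g zero) (funToFin-cong (f≗g ∘ suc))

  does-≟-sym : ∀ {k} (a b : Fin k) → does (a Fin.≟ b) ≡ does (b Fin.≟ a)
  does-≟-sym a b with a Fin.≟ b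
  ... | yes a≡b = sym (dec-true (b Fin.≟ a) (sym a≡b))
  ... | no a≢b  = sym (dec-false (b Fin.≟ a) (a≢b ∘ sym))

  key-sym : ∀ x y → key x y ≡ key y x
  key-sym x y = begin
    x (index S) ⊓ y (index S) , S      ≡⟨ cong (λ S → x (index S) ⊓ y (index S) , S) S≡S′ ⟩
    x (index S′) ⊓ y (index S′) , S′   ≡⟨ cong (_, S′) (min-comm (x (index S′)) (y (index S′))) ⟩
    y (index S′) ⊓ x (index S′) , S′   ∎
    where
    open ≡-Reasoning
    S = differences x y
    S′ = differences y x
    S≡S′ : S ≡ S′
    S≡S′ = funToFin-cong λ j → cong bit (does-≟-sym (x j) (y j))

  marked : Fin m × Fin (2 ^ t) → Point → Bool
  marked (p , S) x = does (x (index S) Fin.≟ p)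

  -- The minimum of two distinct values equals exactly one of them.
  marked-flips : ∀ x y → (∃ λ j → x j ≢ y j) → marked (key x y) y ≡ not (marked (key x y) x)
  marked-flips x y x≢y = go (x i) (y i) (index-differs x y x≢y)
    where
    i = index (differences x y)
    go : ∀ a b → a ≢ b → does (b Fin.≟ a ⊓ b) ≡ not (does (a Fin.≟ a ⊓ b))
    go a b a≢b with min-sel a b
    ... | inj₁ e rewrite e | dec-true (a Fin.≟ a) refl = dec-false (b Fin.≟ a) (a≢b ∘ sym)
    ... | inj₂ e rewrite e | dec-true (b Fin.≟ b) refl = sym (cong not (dec-false (a Fin.≟ b) a≢b))

  marked-compatible : ∀ x y κ →
    compatible (differs? (differences x y) (index (proj₂ κ))) (marked κ x) (marked κ y) ≡ true
  marked-compatible x y (p , S) rewrite differs?-differences x y (index S)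
    with x (index S) Fin.≟ y (index S)
  ... | yes e rewrite e with does (y (index S) Fin.≟ p)
  ...   | true  = refl
  ...   | false = refl
  marked-compatible x y (p , S) | no ¬e with x (index S) Fin.≟ p | y (index S) Fin.≟ p
  ...   | yes a | yes b = contradiction (trans a (sym b)) ¬e
  ...   | yes _ | no _  = refl
  ...   | no _  | _     = refl

  paintPoint : Fin m × Fin (2 ^ t) → Fin m × Fin (2 ^ t) → Point → Fin 3
  paintPoint κ κ′ x = paint (differs? (proj₂ κ) (index (proj₂ κ′)))
                            (differs? (proj₂ κ′) (index (proj₂ κ)))
                            (marked κ x) (marked κ′ x)

  paintPoint-proper : ∀ κ κ′ x y → (∃ λ j → x j ≢ y j) → key x y ≡ κ ⊎ key x y ≡ κ′ →
                      paintPoint κ κ′ x ≢ paintPoint κ κ′ y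
  paintPoint-proper κ κ′ x y x≢y (inj₁ refl) rewrite marked-flips x y x≢y =
    paint-first s₁ s₂ (marked κ x) (marked κ′ x) (marked κ′ y) (marked-compatible x y κ′)
    where
    s₁ = differs? (proj₂ κ) (index (proj₂ κ′))
    s₂ = differs? (proj₂ κ′) (index (proj₂ κ))
  paintPoint-proper κ κ′ x y x≢y (inj₂ refl) rewrite marked-flips x y x≢y =
    paint-second s₁ s₂ (marked κ x) (marked κ y) (marked κ′ x) (marked-compatible x y κ)
    where
    s₁ = differs? (proj₂ κ) (index (proj₂ κ′))
    s₂ = differs? (proj₂ κ′) (index (proj₂ κ))

  module _ {n r : ℕ} (n≤ : n ≤ m ^ t) (m*m≤r : m * m ≤ r) where

    private
      instance
        m*m≢0 : NonZero (m * m)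
        m*m≢0 = m*n≢0 m m {{m^n≢0 2 t}} {{m^n≢0 2 t}}

    -- The digits of `u` in base `m`.
    point : Fin n → Point
    point u = finToFun (inject≤ u n≤)

    encode : Fin m × Fin (2 ^ t) → Fin r
    encode (p , S) = inject≤ (combine p S) m*m≤r

    -- The reduction modulo m² is a left inverse of the inclusion of the m² colours in Fin r.
    decode : Fin r → Fin m × Fin (2 ^ t)
    decode i = remQuot {m} m (toℕ i mod (m * m))

    decode-encode : ∀ κ → decode (encode κ) ≡ κ
    decode-encode (p , S) = trans (cong (remQuot {m} m) (toℕ-injective (begin
      toℕ (toℕ (inject≤ (combine p S) m*m≤r) mod (m * m)) ≡⟨ toℕ-fromℕ< _ ⟩
      toℕ (inject≤ (combine p S) m*m≤r) % (m * m) ≡⟨ cong (_% (m * m)) (toℕ-inject≤ (combine p S) m*m≤r) ⟩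
      toℕ (combine p S) % (m * m) ≡⟨ m<n⇒m%n≡m (toℕ<n (combine p S)) ⟩
      toℕ (combine p S) ∎))) (remQuot-combine p S)
      where
      open ≡-Reasoning

    pointColouring : Fin n → Fin n → Fin r
    pointColouring u v = encode (key (point u) (point v))

    pointColouring-sym : ∀ u v → pointColouring u v ≡ pointColouring v u
    pointColouring-sym u v = cong encode (key-sym (point u) (point v))

    point-distinct : ∀ u v → u ≢ v → ∃ λ j → point u j ≢ point v j
    point-distinct u v u≢v with any? (λ j → ¬? (point u j Fin.≟ point v j))
    ... | yes found = found
    ... | no none = contradiction (inject≤-injective n≤ n≤ u v (begin
      inject≤ u n≤                           ≡⟨ sym (funToFin-finToFin {t} {m} (inject≤ u n≤)) ⟩
      funToFin (point u)                     ≡⟨ funToFin-cong same ⟩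
      funToFin (point v)                     ≡⟨ funToFin-finToFin {t} {m} (inject≤ v n≤) ⟩
      inject≤ v n≤                           ∎)) u≢v
      where
      open ≡-Reasoning
      same : ∀ j → point u j ≡ point v j
      same j = decidable-stable (point u j Fin.≟ point v j) λ ne → none (j , ne)

    pointColouring-threeColourable : ∀ i j → ThreeColourable pointColouring i j
    pointColouring-threeColourable i j = paintPoint (decode i) (decode j) ∘ point , λ u v u≢v c →
      paintPoint-proper (decode i) (decode j) (point u) (point v) (point-distinct u v u≢v) (to c)
      where
      to : ∀ {κ} → encode κ ≡ i ⊎ encode κ ≡ j → κ ≡ decode i ⊎ κ ≡ decode j
      to {κ} (inj₁ e) = inj₁ (trans (sym (decode-encode κ)) (cong decode e))
      to {κ} (inj₂ e) = inj₂ (trans (sym (decode-encode κ)) (cong decode e))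

-- Two-coloured subgraphs and chromatic number

open EdgeColouring

-- Functions are searched through their codes. Decoding the code of `f` returns `f` only pointwise,
-- so `P` has to respect pointwise equality.
decFunction : ∀ {n k} {P : (Fin n → Fin k) → Set} → (∀ f → Dec (P f)) →
              (∀ {f g} → (∀ x → f x ≡ g x) → P f → P g) → Dec (∃ P)
decFunction {n} {k} P? resp = map′ (λ (e , p) → finToFun e , p)
  (λ (f , p) → funToFin f , resp (λ x → sym (finToFun-funToFin f x)) p)
  (any? (λ e → P? (finToFun {k} {n} e)))

Proper : ∀ {n k} → (Fin n → Fin n → Bool) → (Fin n → Fin k) → Set
Proper E f = ∀ u v → T (E u v) → f u ≢ f v

properColouring? : ∀ {n} k (E : Fin n → Fin n → Bool) → Dec (∃ λ (f : Fin n → Fin k) → Proper E f)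
properColouring? k E = decFunction
  (λ f → all? λ u → all? λ v → T? (E u v) →-dec ¬? (f u Fin.≟ f v))
  (λ f≗g proper u v e gu≡gv → proper u v e (trans (f≗g u) (trans gu≡gv (sym (f≗g v)))))

threeColourable? : ∀ {n r} (col : Fin n → Fin n → Fin r) i j → Dec (ThreeColourable col i j)
threeColourable? col i j = decFunction
  (λ f → all? λ u → all? λ v →
    ¬? (u Fin.≟ v) →-dec ((col u v Fin.≟ i) ⊎-dec (col u v Fin.≟ j)) →-dec ¬? (f u Fin.≟ f v))
  (λ f≗g proper u v u≢v c gu≡gv → proper u v u≢v c (trans (f≗g u) (trans gu≡gv (sym (f≗g v)))))

PairwiseThreeColourable : ∀ {n r} → (Fin n → Fin n → Fin r) → Set
PairwiseThreeColourable col = ∀ i j → ThreeColourable col i j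

Avoidable : (r n : ℕ) → Set
Avoidable r n = Σ (EdgeColouring n r) λ c → PairwiseThreeColourable (colour c)

Unavoidable : (r n : ℕ) → Set
Unavoidable r n = (c : EdgeColouring n r) → ∃₂ λ i j → ¬ ThreeColourable (colour c) i j

pairwise? : ∀ {n r} (col : Fin n → Fin n → Fin r) →
            PairwiseThreeColourable col ⊎ ∃₂ λ i j → ¬ ThreeColourable col i j
pairwise? {n} {r} col with any? (λ i → any? λ j → ¬? (threeColourable? col i j))
... | yes bad = inj₂ bad
... | no none = inj₁ λ i j → decidable-stable (threeColourable? col i j) λ ¬t → none (i , j , ¬t)

-- A finite search through all tables of n² colours. It makes the least unavoidable n, which is F_χ,
-- constructively available.
avoidable? : ∀ r n → Unavoidable r n ⊎ Avoidable r n
avoidable? r n = decide (decFunction {n * n} {r} {λ g → Sym g × PairwiseThreeColourable (uncurried g)}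
    (λ g → (all? λ u → all? λ v → uncurried g u v Fin.≟ uncurried g v u) ×-dec
           (all? λ i → all? λ j → threeColourable? (uncurried g) i j))
    (λ f≗g (s , p) →
      (λ u v → trans (sym (f≗g _)) (trans (s u v) (f≗g _))) ,
      (λ i j → proj₁ (p i j) , λ u v u≢v → proj₂ (p i j) u v u≢v ∘ transfer (f≗g (combine u v)))))
  where
  uncurried : (Fin (n * n) → Fin r) → Fin n → Fin n → Fin r
  uncurried g u v = g (combine u v)
  Sym : (Fin (n * n) → Fin r) → Set
  Sym g = ∀ u v → uncurried g u v ≡ uncurried g v u
  transfer : ∀ {a b i j : Fin r} → a ≡ b → b ≡ i ⊎ b ≡ j → a ≡ i ⊎ a ≡ j
  transfer refl c = c
  decide : Dec (∃ λ g → Sym g × PairwiseThreeColourable (uncurried g)) → Unavoidable r n ⊎ Avoidable r n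
  decide (yes (g , s , p)) = inj₂ (record { colour = uncurried g ; colour-sym = s } , p)
  decide (no none) = inj₁ refute
    where
    refute : Unavoidable r n
    refute c with pairwise? (colour c)
    ... | inj₂ bad = bad
    ... | inj₁ good = contradiction (g , sym′ , good′) none
      where
      g : Fin (n * n) → Fin r
      g k = let (u , v) = remQuot n k in colour c u v
      g≗ : ∀ u v → uncurried g u v ≡ colour c u v
      g≗ u v = cong (λ (u , v) → colour c u v) (remQuot-combine u v)
      sym′ : Sym g
      sym′ u v = trans (g≗ u v) (trans (colour-sym c u v) (sym (g≗ v u)))
      good′ : PairwiseThreeColourable (uncurried g)
      good′ i j = proj₁ (good i j) , λ u v u≢v → proj₂ (good i j) u v u≢v ∘ transfer (sym (g≗ u v))

∣p∪q∣≤∣p∣+∣q∣ : ∀ {n} (p q : Subset n) → ∣ p ∪ q ∣ ≤ ∣ p ∣ + ∣ q ∣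
∣p∪q∣≤∣p∣+∣q∣ []          []          = z≤n
∣p∪q∣≤∣p∣+∣q∣ (false ∷ p) (false ∷ q) = ∣p∪q∣≤∣p∣+∣q∣ p q
∣p∪q∣≤∣p∣+∣q∣ (false ∷ p) (true ∷ q)  =
  ≤-trans (s≤s (∣p∪q∣≤∣p∣+∣q∣ p q)) (≤-reflexive (sym (+-suc ∣ p ∣ ∣ q ∣)))
∣p∪q∣≤∣p∣+∣q∣ (true ∷ p)  (false ∷ q) = s≤s (∣p∪q∣≤∣p∣+∣q∣ p q)
∣p∪q∣≤∣p∣+∣q∣ (true ∷ p)  (true ∷ q)  =
  s≤s (≤-trans (∣p∪q∣≤∣p∣+∣q∣ p q) (+-monoʳ-≤ ∣ p ∣ (n≤1+n ∣ q ∣)))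

change-point : ∀ {P : ℕ → Set} → (∀ t → Dec (P t)) → P 0 → ∀ n → ¬ P n → ∃ λ t → P t × ¬ P (suc t)
change-point P? P0 zero    ¬Pn = contradiction P0 ¬Pn
change-point P? P0 (suc n) ¬Pn with P? n
... | yes Pn  = n , Pn , ¬Pn
... | no ¬Pn′ = change-point P? P0 n ¬Pn′

module _ {n r : ℕ} (c : EdgeColouring n r) (i j : Fin r) where

  Joined : ℕ → Fin n → Fin n → Set
  Joined t u v = u ≢ v × (colour c u v ≡ i ⊎ colour c u v ≡ j) × toℕ u < t × toℕ v < t

  joined? : ∀ t u v → Dec (Joined t u v)
  joined? t u v = ¬? (u Fin.≟ v) ×-dec ((colour c u v Fin.≟ i) ⊎-dec (colour c u v Fin.≟ j)) ×-dec
                  (toℕ u <? t) ×-dec (toℕ v <? t)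

  below : ℕ → Subset n
  below t = tabulate (λ u → isYes (toℕ u <? t))

  ∈below : ∀ {t u} → toℕ u < t → u ∈ below t
  ∈below {t} {u} u<t = lookup⇒[]= u (below t)
    (trans (lookup∘tabulate _ u) (Equivalence.to T-≡ (fromWitness {a? = toℕ u <? t} u<t)))

  joined-sym : ∀ {t u v} → Joined t u v → Joined t v u
  joined-sym {u = u} {v} (u≢v , uv , u< , v<) =
    u≢v ∘ sym , subst (λ k → k ≡ i ⊎ k ≡ j) (colour-sym c u v) uv , v< , u<

  twoColours : ℕ → Subgraph n
  twoColours t = record
    { vertices = below t
    ; edge     = λ u v → isYes (joined? t u v)
    ; edge-sym = λ {u} {v} e → fromWitness {a? = joined? t v u} (joined-sym (toWitness {a? = joined? t u v} e))
    ; edge-irr = λ {u} e → proj₁ (toWitness {a? = joined? t u u} e) refl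
    ; edge-end = λ {u} {v} e → ∈below (proj₁ (proj₂ (proj₂ (toWitness {a? = joined? t u v} e))))
    }

  coloursOn-twoColours : ∀ t → ∣ coloursOn c (twoColours t) ∣ ≤ 2
  coloursOn-twoColours t = ≤-trans (p⊆q⇒∣p∣≤∣q∣ sub) (≤-trans (∣p∪q∣≤∣p∣+∣q∣ Subset.⁅ i ⁆ Subset.⁅ j ⁆)
    (≤-reflexive (cong₂ _+_ (∣⁅x⁆∣≡1 i) (∣⁅x⁆∣≡1 j))))
    where
    used? : ∀ k → Dec (∃₂ λ u v → T (isYes (joined? t u v)) × colour c u v ≡ k)
    used? k = any? λ u → any? λ v → T? (isYes (joined? t u v)) ×-dec (colour c u v Fin.≟ k)
    sub : coloursOn c (twoColours t) Subset.⊆ Subset.⁅ i ⁆ ∪ Subset.⁅ j ⁆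
    sub {k} k∈ = in-pair (does-true (used? k) (trans (sym (lookup∘tabulate _ k)) ([]=⇒lookup k∈)))
      where
      in-pair : (∃₂ λ u v → T (isYes (joined? t u v)) × colour c u v ≡ k) → k ∈ Subset.⁅ i ⁆ ∪ Subset.⁅ j ⁆
      in-pair (u , v , e , refl) with proj₁ (proj₂ (toWitness {a? = joined? t u v} e))
      ... | inj₁ eq = x∈p∪q⁺ (inj₁ (subst (_∈ Subset.⁅ i ⁆) (sym eq) (x∈⁅x⁆ i)))
      ... | inj₂ eq = x∈p∪q⁺ (inj₂ (subst (_∈ Subset.⁅ j ⁆) (sym eq) (x∈⁅x⁆ j)))

  fourColour : ℕ → (Fin n → Fin 3) → Fin n → Fin 4
  fourColour t f u with toℕ u ≟ t
  ... | yes _ = Fin.fromℕ 3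
  ... | no _  = inject₁ (f u)

  -- The colour classes restricted to an initial segment of the vertices, cut at the
  -- first vertex that needs a fourth colour.
  four-chromatic : ¬ ThreeColourable (colour c) i j → ∃ λ t → 4 IsChromatic Subgraph.graph (twoColours t)
  four-chromatic ¬three = at-change (change-point (λ t → properColouring? 3 (E t)) none n (¬three ∘ all-vertices))
    where
    E : ℕ → Fin n → Fin n → Bool
    E t u v = isYes (joined? t u v)
    none : ∃ λ (f : Fin n → Fin 3) → Proper (E 0) f
    none = (λ _ → zero) , λ u v e →
      contradiction (proj₁ (proj₂ (proj₂ (toWitness {a? = joined? 0 u v} e)))) λ ()
    all-vertices : (∃ λ (f : Fin n → Fin 3) → Proper (E n) f) → ThreeColourable (colour c) i j
    all-vertices (f , proper) = f , λ u v u≢v uv →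
      proper u v (fromWitness {a? = joined? n u v} (u≢v , uv , toℕ<n u , toℕ<n v))
    at-change : (∃ λ t → (∃ λ (f : Fin n → Fin 3) → Proper (E t) f) ×
                         ¬ ∃ λ (f : Fin n → Fin 3) → Proper (E (suc t)) f) →
                ∃ λ t → 4 IsChromatic Subgraph.graph (twoColours t)
    at-change (t , (f , proper) , ¬next) = suc t ,
      (g ∘ proj₁ , λ {u} {v} e →
        g-proper (proj₁ u) (proj₁ v) (toWitness {a? = joined? (suc t) (proj₁ u) (proj₁ v)} e)) ,
      λ k col → ≰⇒> λ k≤3 → ¬next (extend k≤3 col)
      where
      g : Fin n → Fin 4
      g = fourColour t f
      g-proper : ∀ u v → Joined (suc t) u v → g u ≢ g v
      g-proper u v (u≢v , uv , u<1+t , v<1+t) with toℕ u ≟ t | toℕ v ≟ t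
      ... | yes u≡t | yes v≡t = λ _ → u≢v (toℕ-injective (trans u≡t (sym v≡t)))
      ... | yes _   | no _    = fromℕ≢inject₁
      ... | no _    | yes _   = fromℕ≢inject₁ ∘ sym
      ... | no u≢t  | no v≢t  = proper u v (fromWitness {a? = joined? t u v}
        (u≢v , uv , ≤∧≢⇒< (≤-pred u<1+t) u≢t , ≤∧≢⇒< (≤-pred v<1+t) v≢t)) ∘ inject₁-injective
      extend : ∀ {k} → k ≤ 3 → Colourable (Subgraph.graph (twoColours (suc t))) k →
               ∃ λ (f : Fin n → Fin 3) → Proper (E (suc t)) f
      extend k≤3 (φ , φ-proper) = h , h-proper
        where
        h : Fin n → Fin 3
        h u with u ∈? below (suc t)
        ... | yes u∈ = inject≤ (φ (u , u∈)) k≤3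
        -- Vertices outside the segment lie on no edge, so any value will do.
        ... | no _   = zero
        h-proper : Proper (E (suc t)) h
        h-proper u v e with u ∈? below (suc t) | v ∈? below (suc t)
        ... | yes u∈ | yes v∈ = φ-proper {u , u∈} {v , v∈} e ∘ inject≤-injective k≤3 k≤3 _ _
        ... | no u∉  | _      = contradiction (Subgraph.edge-end (twoColours (suc t)) {u} {v} e) u∉
        ... | yes _  | no v∉  = contradiction
          (Subgraph.edge-end (twoColours (suc t)) {v} {u} (Subgraph.edge-sym (twoColours (suc t)) {u} {v} e)) v∉

unavoidable⇒ramsey : ∀ {r n} → Unavoidable r n → ChromaticRamsey r 4 3 n
unavoidable⇒ramsey bad c with bad c
... | i , j , ¬three = let (t , χ) = four-chromatic c i j ¬three in
  twoColours c i j t , χ , coloursOn-twoColours c i j t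

-- The given colour `d` fills both places if `S` is empty, and a single element is repeated.
covered-by-pair : ∀ {r} → Fin r → (S : Subset r) → ∣ S ∣ ≤ 2 → ∃₂ λ i j → ∀ {x} → x ∈ S → x ≡ i ⊎ x ≡ j
covered-by-pair d S ∣S∣≤2 with nonempty? S
... | no empty = d , d , λ x∈ → contradiction (_ , x∈) empty
... | yes (i , i∈) with nonempty? (S - i)
...   | no empty = i , i , λ {x} x∈ →
  inj₁ (decidable-stable (x Fin.≟ i) λ x≢i → empty (x , x∈p∧x≢y⇒x∈p-y x∈ x≢i))
...   | yes (j , j∈) = i , j , cover
  where
  cover : ∀ {x} → x ∈ S → x ≡ i ⊎ x ≡ j
  cover {x} x∈ with x Fin.≟ i | x Fin.≟ j
  ... | yes x≡i | _       = inj₁ x≡i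
  ... | no _    | yes x≡j = inj₂ x≡j
  ... | no x≢i  | no x≢j  = contradiction 3≤∣S∣ (<⇒≱ (s≤s ∣S∣≤2))
    where
    x∈′ : x ∈ S - i - j
    x∈′ = x∈p∧x≢y⇒x∈p-y (x∈p∧x≢y⇒x∈p-y x∈ x≢i) x≢j
    3≤∣S∣ : 3 ≤ ∣ S ∣
    3≤∣S∣ = ≤-trans (s≤s (≤-trans (s≤s (≤-<-trans z≤n (x∈p⇒∣p-x∣<∣p∣ x∈′))) (x∈p⇒∣p-x∣<∣p∣ j∈)))
                    (x∈p⇒∣p-x∣<∣p∣ i∈)

-- A subgraph with at most two colours lies in the union of two colour classes and inherits its
-- 3-colouring.
avoidable⇒¬ramsey : ∀ {r n} → Fin r → Avoidable r n → ¬ ChromaticRamsey r 4 3 n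
avoidable⇒¬ramsey {r} {n} d (c , pairs) ramsey with ramsey c
... | H , (_ , 4≤) , few with covered-by-pair d (coloursOn c H) few
...   | i , j , cover = contradiction (4≤ 3 (f ∘ proj₁ , λ {u} {v} → f-proper (proj₁ u) (proj₁ v)))
                                      λ { (s≤s (s≤s (s≤s ()))) }
  where
  open Subgraph H
  f = proj₁ (pairs i j)
  used : ∀ u v → T (edge u v) → colour c u v ∈ coloursOn c H
  used u v e = lookup⇒[]= _ _ (trans (lookup∘tabulate _ (colour c u v))
    (dec-true (any? λ a → any? λ b → T? (edge a b) ×-dec (colour c a b Fin.≟ colour c u v))
              (u , v , e , refl)))
  f-proper : ∀ u v → T (edge u v) → f u ≢ f v
  f-proper u v e = proj₂ (pairs i j) u v (λ { refl → edge-irr e }) (cover (used u v e))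

-- A positive alternative `Q` replaces the negation of `P`, so that below the minimum an actual
-- avoiding colouring is at hand.
least : ∀ {P Q : ℕ → Set} → (∀ n → P n ⊎ Q n) → ∀ N → P N → ∃ λ n → n ≤ N × P n × (∀ m → m < n → Q m)
least {P} {Q} P⊎Q N PN with search N
  where
  extend : ∀ {s} → (∀ m → m < s → Q m) → Q s → ∀ m → m < suc s → Q m
  extend below Qs m m<1+s with m≤n⇒m<n∨m≡n (≤-pred m<1+s)
  ... | inj₁ m<s  = below m m<s
  ... | inj₂ refl = Qs
  search : ∀ s → (∃ λ n → n < s × P n × (∀ m → m < n → Q m)) ⊎ (∀ m → m < s → Q m)
  search zero = inj₂ λ _ ()
  search (suc s) with search s
  ... | inj₁ (n , n<s , found) = inj₁ (n , m≤n⇒m≤1+n n<s , found)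
  ... | inj₂ below with P⊎Q s
  ...   | inj₁ Ps = inj₁ (s , ≤-refl , Ps , below)
  ...   | inj₂ Qs = inj₂ (extend below Qs)
... | inj₁ (n , n<N , found) = n , <⇒≤ n<N , found
... | inj₂ below = N , ≤-refl , PN , below

-- Comparison of cuts

-- Given directly in lowest terms, so that numerator and denominator compute for variable `k`.
nat : ℕ → ℚ
nat k = mkℚ (ℤ.+ k) 0 (Coprimality.sym (1-coprimeTo k))

/1≡nat : ∀ k → (ℤ.+ k) ℚ./ 1 ≡ nat k
/1≡nat k = ℚₚ.fromℚᵘ-toℚᵘ (nat k)

nat-* : ∀ a b → nat (a * b) ≡ nat a ℚ.* nat b
nat-* a b = trans (sym (/1≡nat (a * b))) (cong (ℚ._/ 1) (ℤₚ.pos-* a b))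

nat-mono : ∀ {a b} → a ≤ b → nat a ℚ.≤ nat b
nat-mono a≤b = *≤* (ℤₚ.*-monoʳ-≤-nonNeg (ℤ.+ 1) (ℤ.+≤+ a≤b))

nat-≤ : ∀ k q → 0ℚ ℚ.< q → k * ↧ₙ q ≤ ℤ.∣ ↥ q ∣ → nat k ℚ.≤ q
nat-≤ k (mkℚ (ℤ.+ c) d-1 _) _ le = *≤* (subst₂ ℤ._≤_ (ℤₚ.pos-* k (suc d-1)) (sym (ℤₚ.*-identityʳ (ℤ.+ c))) (ℤ.+≤+ le))
nat-≤ k (mkℚ (ℤ.-[1+ c ]) d-1 _) (*<* ())

≤-nat : ∀ k q → nat k ℚ.≤ q → k * ↧ₙ q ≤ ℤ.∣ ↥ q ∣
≤-nat k (mkℚ (ℤ.+ c) d-1 _) (*≤* le) =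
  ℤₚ.drop‿+≤+ (subst₂ ℤ._≤_ (sym (ℤₚ.pos-* k (suc d-1))) (ℤₚ.*-identityʳ (ℤ.+ c)) le)
≤-nat k (mkℚ (ℤ.-[1+ c ]) d-1 _) (*≤* le) =
  contradiction (ℤₚ.≤-trans (subst (ℤ.+ 0 ℤ.≤_) (ℤₚ.pos-* k (suc d-1)) (ℤ.+≤+ z≤n)) le) λ ()

^-distribʳ-* : ∀ d a b → (a * b) ^ d ≡ a ^ d * b ^ d
^-distribʳ-* zero    a b = refl
^-distribʳ-* (suc d) a b = trans (cong (a * b *_) (^-distribʳ-* d a b)) (eq a b (a ^ d) (b ^ d))
  where
  eq : ∀ a b x y → a * b * (x * y) ≡ a * x * (b * y)
  eq = solve-∀

^-cancelʳ-≤ : ∀ {a b} d .{{_ : NonZero d}} → a ^ d ≤ b ^ d → a ≤ b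
^-cancelʳ-≤ d le = ≮⇒≥ λ b<a → <⇒≱ (^-monoˡ-< d b<a) le


-- log r < 5t, and 25 < 36 leaves room for the strict inequality between 1/36 and 1/25.
≤ᴿ-fromℕ : ∀ {r n t} → r < 2 ^ (5 * t) → 0 < t → 2 ^ (t * t) ≤ n → 2^ (log₂ r ² /ᴿ 36) ≤ᴿ fromℕ n
≤ᴿ-fromℕ {r} {n} {t} r< 0<t ≤n {s} n<s =
  -- The exponent is t² = (5t)²/25, and 2^(t²) ≤ n < s.
  0<s , nat (t * t) ,
  (x ℚ.* x , (ℤ.+ 1) ℚ./ 25 , (x , x , log<x , log<x , ℚₚ.≤-refl) ,
   from-yes ((ℤ.+ 1) ℚ./ 36 ℚₚ.<? (ℤ.+ 1) ℚ./ 25) , ℚₚ.≤-reflexive x²/25) ,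
  pow
  where
  x = nat (5 * t)
  nat-n<s : nat n ℚ.< s
  nat-n<s = subst (ℚ._< s) (/1≡nat n) n<s
  0<s : 0ℚ ℚ.< s
  0<s = ℚₚ.≤-<-trans (nat-mono {0} {n} z≤n) nat-n<s
  log<x : log₂ r x
  log<x = ℚₚ.<-≤-trans (from-yes (0ℚ ℚₚ.<? nat 1)) (nat-mono (*-mono-≤ (s≤s (z≤n {4})) 0<t)) ,
          subst (_< 2 ^ (5 * t)) (sym (*-identityʳ r)) r<
  x²/25 : x ℚ.* x ℚ.* ((ℤ.+ 1) ℚ./ 25) ≡ nat (t * t)
  x²/25 = begin
    x ℚ.* x ℚ.* ((ℤ.+ 1) ℚ./ 25)                       ≡⟨ cong (λ y → y ℚ.* y ℚ.* ((ℤ.+ 1) ℚ./ 25)) (nat-* 5 t) ⟩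
    (nat 5 ℚ.* nat t) ℚ.* (nat 5 ℚ.* nat t) ℚ.* ((ℤ.+ 1) ℚ./ 25)
      ≡⟨ solve 3 (λ a b c → (a :* b) :* (a :* b) :* c := (a :* a :* c) :* (b :* b)) refl
           (nat 5) (nat t) ((ℤ.+ 1) ℚ./ 25) ⟩
    (nat 5 ℚ.* nat 5 ℚ.* ((ℤ.+ 1) ℚ./ 25)) ℚ.* (nat t ℚ.* nat t) ≡⟨⟩
    1ℚ ℚ.* (nat t ℚ.* nat t)                         ≡⟨ ℚₚ.*-identityˡ _ ⟩
    nat t ℚ.* nat t                                  ≡⟨ sym (nat-* t t) ⟩
    nat (t * t)                                      ∎
    where
    open ≡-Reasoning
    open +-*-Solver
  pow : Pow2≤ (nat (t * t)) s
  pow = subst₂ _≤_ (cong (2 ^ (t * t) *_) (sym (^-identityʳ (↧ₙ s)))) (sym (^-identityʳ ℤ.∣ ↥ s ∣))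
    (≤-trans (*-monoˡ-≤ (↧ₙ s) ≤n) (≤-nat n s (ℚₚ.<⇒≤ nat-n<s)))

≤-log₂ : ∀ {r ℓ b} → 2 ^ ℓ ≤ r → log₂ r b → nat ℓ ℚ.≤ b
≤-log₂ {r} {ℓ} {b} 2^ℓ≤r (0<b , r^d<2^c) = nat-≤ ℓ b 0<b (<⇒≤ (^-cancelˡ-< (begin-strict
  2 ^ (ℓ * ↧ₙ b)      ≡⟨ sym (^-*-assoc 2 ℓ (↧ₙ b)) ⟩
  (2 ^ ℓ) ^ ↧ₙ b      ≤⟨ ^-monoˡ-≤ (↧ₙ b) 2^ℓ≤r ⟩
  r ^ ↧ₙ b            <⟨ r^d<2^c ⟩
  2 ^ ℤ.∣ ↥ b ∣       ∎)))
  where open ≤-Reasoning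

-- Both sides are raised to the denominator of `w`, where 2^w becomes an integer power.
pow2-≤ : ∀ {M w u} → nat M ℚ.≤ w → 0ℚ ℚ.< u → Pow2≤ w u → nat (2 ^ M) ℚ.≤ u
pow2-≤ {M} {w} {u} M≤w 0<u 2^w≤u = nat-≤ (2 ^ M) u 0<u (^-cancelʳ-≤ (↧ₙ w) (begin
  (2 ^ M * ↧ₙ u) ^ ↧ₙ w                 ≡⟨ ^-distribʳ-* (↧ₙ w) (2 ^ M) (↧ₙ u) ⟩
  (2 ^ M) ^ ↧ₙ w * ↧ₙ u ^ ↧ₙ w          ≡⟨ cong (_* ↧ₙ u ^ ↧ₙ w) (^-*-assoc 2 M (↧ₙ w)) ⟩
  2 ^ (M * ↧ₙ w) * ↧ₙ u ^ ↧ₙ w          ≤⟨ *-monoˡ-≤ (↧ₙ u ^ ↧ₙ w) (^-monoʳ-≤ 2 (≤-nat M w M≤w)) ⟩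
  2 ^ ℤ.∣ ↥ w ∣ * ↧ₙ u ^ ↧ₙ w           ≤⟨ 2^w≤u ⟩
  ℤ.∣ ↥ u ∣ ^ ↧ₙ w                      ∎))
  where open ≤-Reasoning

*-mono-≤-nonNeg : ∀ {a b c d} → 0ℚ ℚ.≤ a → 0ℚ ℚ.≤ d → a ℚ.≤ b → c ℚ.≤ d → a ℚ.* c ℚ.≤ b ℚ.* d
*-mono-≤-nonNeg {a} {b} {c} {d} 0≤a 0≤d a≤b c≤d = ℚₚ.≤-trans
  (ℚₚ.*-monoˡ-≤-nonNeg a {{ℚ.nonNegative 0≤a}} c≤d) (ℚₚ.*-monoʳ-≤-nonNeg d {{ℚ.nonNegative 0≤d}} a≤b)

square-cancel-≤ : ∀ {a b} → 0ℚ ℚ.≤ b → a ℚ.* a ℚ.≤ b ℚ.* b → a ℚ.≤ b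
square-cancel-≤ {a} {b} 0≤b a²≤b² = ℚₚ.≮⇒≥ λ b<a →
  let 0<a = ℚₚ.≤-<-trans 0≤b b<a in
  ℚₚ.<-irrefl refl (ℚₚ.≤-<-trans a²≤b² (ℚₚ.≤-<-trans
    (ℚₚ.*-monoʳ-≤-nonNeg b {{ℚ.nonNegative 0≤b}} (ℚₚ.<⇒≤ b<a))
    (ℚₚ.*-monoʳ-<-pos a {{ℚ.positive 0<a}} b<a)))

nat≥0 : ∀ k → 0ℚ ℚ.≤ nat k
nat≥0 k = nat-mono {0} {k} z≤n

-- An element s of the right-hand cut unfolds into rationals t > 1, p > 130, q² ≥ ab with a > r and
-- b > log r, w ≥ pq and u ≥ 2^w with tu ≤ s. Then M ≤ 130q ≤ pq ≤ w, whence n ≤ 2^M ≤ u < tu ≤ s.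
fromℕ-≤ᴿ : ∀ {r ℓ n M} → 2 ^ ℓ ≤ r → M * M ≤ 130 * 130 * (r * ℓ) → n ≤ 2 ^ M →
           fromℕ n ≤ᴿ fromℚ 1ℚ *ᴿ 2^ (fromℕ 130 *ᴿ √ (fromℕ r *ᴿ log₂ r))
fromℕ-≤ᴿ {r} {ℓ} {n} {M} 2^ℓ≤r M²≤ n≤ {s}
  (t , u , 1<t , (0<u , w , (p , q , 130<p , (0<q , a , b , r<a , b>log , ab≤q²) , pq≤w) , 2^w≤u) , tu≤s) =
  subst (ℚ._< s) (sym (/1≡nat n))
        (ℚₚ.≤-<-trans (nat-mono n≤) (ℚₚ.≤-<-trans (pow2-≤ {M} {w} {u} M≤w 0<u 2^w≤u) u<s))
  where
  open ℚₚ.≤-Reasoning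
  0≤q = ℚₚ.<⇒≤ 0<q
  130≤p : nat 130 ℚ.≤ p
  130≤p = ℚₚ.<⇒≤ 130<p
  r≤a : nat r ℚ.≤ a
  r≤a = ℚₚ.<⇒≤ (subst (ℚ._< a) (/1≡nat r) r<a)
  rℓ≤q² : nat r ℚ.* nat ℓ ℚ.≤ q ℚ.* q
  rℓ≤q² = ℚₚ.≤-trans
    (*-mono-≤-nonNeg (nat≥0 r) (ℚₚ.<⇒≤ (proj₁ b>log)) r≤a (≤-log₂ {r} {ℓ} {b} 2^ℓ≤r b>log)) ab≤q²
  0≤130q : 0ℚ ℚ.≤ nat 130 ℚ.* q
  0≤130q = *-mono-≤-nonNeg {0ℚ} {nat 130} {0ℚ} {q} ℚₚ.≤-refl 0≤q (nat≥0 130) 0≤q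
  M²≤[130q]² : nat M ℚ.* nat M ℚ.≤ (nat 130 ℚ.* q) ℚ.* (nat 130 ℚ.* q)
  M²≤[130q]² = begin
    nat M ℚ.* nat M                             ≡⟨ sym (nat-* M M) ⟩
    nat (M * M)                                 ≤⟨ nat-mono M²≤ ⟩
    nat (130 * 130 * (r * ℓ))                   ≡⟨ nat-* (130 * 130) (r * ℓ) ⟩
    nat (130 * 130) ℚ.* nat (r * ℓ)             ≡⟨ cong (nat (130 * 130) ℚ.*_) (nat-* r ℓ) ⟩
    nat (130 * 130) ℚ.* (nat r ℚ.* nat ℓ)       ≤⟨ ℚₚ.*-monoˡ-≤-nonNeg (nat (130 * 130)) rℓ≤q² ⟩
    nat (130 * 130) ℚ.* (q ℚ.* q)               ≡⟨ cong (ℚ._* (q ℚ.* q)) (nat-* 130 130) ⟩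
    (nat 130 ℚ.* nat 130) ℚ.* (q ℚ.* q)         ≡⟨ squares (nat 130) q ⟩
    (nat 130 ℚ.* q) ℚ.* (nat 130 ℚ.* q)         ∎
    where
    squares : ∀ x y → (x ℚ.* x) ℚ.* (y ℚ.* y) ≡ (x ℚ.* y) ℚ.* (x ℚ.* y)
    squares = solve 2 (λ x y → (x :* x) :* (y :* y) := (x :* y) :* (x :* y)) refl
      where open +-*-Solver
  M≤w : nat M ℚ.≤ w
  M≤w = begin
    nat M          ≤⟨ square-cancel-≤ {nat M} {nat 130 ℚ.* q} 0≤130q M²≤[130q]² ⟩
    nat 130 ℚ.* q  ≤⟨ ℚₚ.*-monoʳ-≤-nonNeg q {{ℚ.nonNegative 0≤q}} 130≤p ⟩
    p ℚ.* q        ≤⟨ pq≤w ⟩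
    w              ∎
  u<s : u ℚ.< s
  u<s = begin-strict
    u              ≡⟨ sym (ℚₚ.*-identityˡ u) ⟩
    1ℚ ℚ.* u       <⟨ ℚₚ.*-monoˡ-<-pos u {{ℚ.positive 0<u}} 1<t ⟩
    t ℚ.* u        ≤⟨ tu≤s ⟩
    s              ∎

-- The bounds

-- Here `suc s` is ⌊ℓ/2⌋. The first bound lets the 4^t colours fit into r, the second yields log r <
-- 5t.
half : ∀ ℓ → 2 ≤ ℓ → ∃ λ s → 2 * suc s ≤ ℓ × suc ℓ ≤ 5 * suc s
half (suc zero) (s≤s ())
half (suc (suc zero))       _ = 0 , ≤-refl , ≤ᵇ⇒≤ 3 5 _
half (suc (suc (suc zero))) _ = 0 , ≤ᵇ⇒≤ 2 3 _ , ≤ᵇ⇒≤ 4 5 _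
half (suc (suc ℓ@(suc (suc _)))) _ with half ℓ (s≤s (s≤s z≤n))
... | s , lo , hi = suc s , ≤-trans (≤-reflexive (*-suc 2 (suc s))) (+-monoʳ-≤ 2 lo) ,
  ≤-trans (+-mono-≤ (≤ᵇ⇒≤ 2 5 _) hi) (≤-reflexive (sym (*-suc 5 (suc s))))

avoidable : ∀ {r n} s → 2 ^ (2 * suc s) ≤ r → n ≤ 2 ^ (suc s * suc s) → Avoidable r n
avoidable {r} {n} s colours≤ n≤ =
  record { colour = pointColouring s n≤′ r≥ ; colour-sym = pointColouring-sym s n≤′ r≥ } ,
  pointColouring-threeColourable s n≤′ r≥
  where
  t = suc s
  n≤′ : n ≤ (2 ^ t) ^ t
  n≤′ = ≤-trans n≤ (≤-reflexive (sym (^-*-assoc 2 t t)))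
  r≥ : 2 ^ t * 2 ^ t ≤ r
  r≥ = ≤-trans (≤-reflexive (trans (sym (^-distribˡ-+-* 2 t t)) (cong (λ z → 2 ^ (t + z)) (sym (+-identityʳ t))))) colours≤

2^70x<2^71x : ∀ x → 0 < x → 2 ^ (70 * x) < 2 ^ (71 * x)
2^70x<2^71x x 0<x = ^-monoʳ-< 2 (s≤s (s≤s z≤n)) {70 * x} {71 * x} (*-monoˡ-< x {{>-nonZero 0<x}} (≤ᵇ⇒≤ 71 71 _))

-- An avoiding colouring would have order at most 2^(70x); the exponent 71x lies strictly beyond
-- this.
unavoidable : ∀ {r} ℓ h → r < 2 ^ suc ℓ → r ≤ (32 + h) * (32 + h) * suc ℓ →
              Unavoidable r (2 ^ (71 * ((32 + h) * suc ℓ)))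
unavoidable {r} ℓ h r< r≤ = decide (avoidable? r (2 ^ (71 * x)))
  where
  x = (32 + h) * suc ℓ
  decide : Unavoidable r (2 ^ (71 * x)) ⊎ Avoidable r (2 ^ (71 * x)) → Unavoidable r (2 ^ (71 * x))
  decide (inj₁ bad)         = bad
  decide (inj₂ (c , pairs)) = contradiction
    (order-bound (EdgeColouring.colour c) (λ i j → proj₁ (pairs i j)) (λ i j → proj₂ (pairs i j))
                 (suc ℓ) (s≤s z≤n) (<⇒≤ r<) h r≤)
    (<⇒≱ (2^70x<2^71x x (s≤s z≤n)))

theorem1p6 : ∃₂ λ (C : ℚ) (r₀ : ℕ) → 0ℚ ℚ.< C × 0 < r₀ ×
    (∀ (r : ℕ) → r₀ ≤ r →
    ∃ λ (n : ℕ) → n IsFχ⟨ r , 4 , 3 ⟩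
    × 2^ (log₂ r ² /ᴿ 36) ≤ᴿ fromℕ n
    × fromℕ n ≤ᴿ fromℚ C *ᴿ 2^ (fromℕ 130 *ᴿ √ (fromℕ r *ᴿ log₂ r)))
theorem1p6 = 1ℚ , 2 ^ 14 , from-yes (0ℚ ℚₚ.<? 1ℚ) , s≤s z≤n , bounds
  where
  Bounds : ℕ → ℕ → Set
  Bounds r n = n IsFχ⟨ r , 4 , 3 ⟩ × 2^ (log₂ r ² /ᴿ 36) ≤ᴿ fromℕ n
    × fromℕ n ≤ᴿ fromℚ 1ℚ *ᴿ 2^ (fromℕ 130 *ᴿ √ (fromℕ r *ᴿ log₂ r))
  bounds : ∀ r → 2 ^ 14 ≤ r → ∃ (Bounds r)
  bounds r r₀≤r = with-log (floor-log₂ r 1≤r)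
    where
    1≤r : 1 ≤ r
    1≤r = ≤-trans (m^n>0 2 14) r₀≤r
    with-log : (∃ λ ℓ → 2 ^ ℓ ≤ r × r < 2 ^ suc ℓ) → ∃ (Bounds r)
    with-log (ℓ , 2^ℓ≤r , r<) = with-parameters (half ℓ (≤-trans (≤ᵇ⇒≤ 2 14 _) 14≤ℓ)) (parameters 14≤ℓ 2^ℓ≤r)
      where
      14≤ℓ : 14 ≤ ℓ
      14≤ℓ = ≤-pred (^-cancelˡ-< {14} {suc ℓ} (≤-<-trans r₀≤r r<))
      with-parameters : (∃ λ s → 2 * suc s ≤ ℓ × suc ℓ ≤ 5 * suc s) →
        (∃ λ h → r ≤ (32 + h) * (32 + h) * suc ℓ ×
          (71 * ((32 + h) * suc ℓ)) * (71 * ((32 + h) * suc ℓ)) ≤ 130 * 130 * (r * ℓ)) → ∃ (Bounds r)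
      with-parameters (s , 2t≤ℓ , ℓ<5t) (h , r≤ , M²≤) =
        with-least (least (avoidable? r) (2 ^ M) (unavoidable ℓ h r< r≤))
        where
        M = 71 * ((32 + h) * suc ℓ)
        t = suc s
        with-least : (∃ λ n → n ≤ 2 ^ M × Unavoidable r n × (∀ m → m < n → Avoidable r m)) → ∃ (Bounds r)
        -- F_χ is the least unavoidable order: every smaller order has an avoiding colouring.
        with-least (n , n≤ , bad , below) = n ,
          (unavoidable⇒ramsey bad , λ m ramsey → ≮⇒≥ λ m<n → avoidable⇒¬ramsey (Fin.fromℕ< 1≤r) (below m m<n) ramsey) ,
          ≤ᴿ-fromℕ {r} {n} {t} (<-≤-trans r< (^-monoʳ-≤ 2 ℓ<5t)) (s≤s z≤n) (≰⇒≥ too-small) ,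
          fromℕ-≤ᴿ {r} {ℓ} {n} {M} 2^ℓ≤r M²≤ n≤
          where
          too-small : ¬ n ≤ 2 ^ (t * t)
          too-small n≤t² = conflict (avoidable s (≤-trans (^-monoʳ-≤ 2 2t≤ℓ) 2^ℓ≤r) n≤t²)
            where
            conflict : ¬ Avoidable r n
            conflict (c , pairs) = let (i , j , ¬three) = bad c in ¬three (pairs i j)
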